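{- Let $\mathcal R=(R,<,+,0,\ldots)$ be a definably complete expansion of a densely linearly ordered abelian group. The following are equivalent: (1) Any definable closed subset of $R$ is either discrete or contains a nonempty open interval. (2) The open core of $\mathcal R$ is locally o-minimal. Furthermore, every set definable in the open core of $\mathcal R$ is constructible when one of (equivalently, both of) the conditions (1) and (2) is satisfied.
   Context: "Definable" means definable in the given structure with parameters. $R$ carries the order topology and $R^n$ the product topology. An open interval is a set of the form $\{x\in R \mid a<x<b\}$ with $a,b\in R$. An expansion $(R,<,\ldots)$ of a densely linearly ordered set without endpoints is definably complete if every definable subset of $R$ has a supremum and an infimum in $R\cup\{\pm\infty\}$. It is locally o-minimal if, for every definable subset $X$ of $R$ and every point $a\in R$, there exists an open interval $I$ containing $a$ such that $X\cap I$ is a finite union of points and open intervals. The open core of $\mathcal R$ is the reduct of $\mathcal R$ generated by its definable open sets, i.e. the structure with universe $R$ whose basic relations are all the open subsets of $R^n$ ($n\ge 1$) that are definable in $\mathcal R$. A set is constructible if it is a finite boolean combination of open sets. -}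

module Defs where

open import Level using (Level; Lift; _⊔_) renaming (suc to lsuc)
open import Algebra.Structures using (IsAbelianGroup)
open import Data.Empty using (⊥)
open import Data.Fin.Base using (Fin)
open import Data.List.Base using (List)
open import Data.List.Relation.Unary.Any using (Any)
open import Data.Nat.Base using (ℕ; _+_; _≤_; z≤n; s≤s)
open import Data.Product.Base using (_×_; _,_; Σ-syntax; ∃-syntax; proj₁; proj₂)
open import Data.Sum.Base using (_⊎_)
open import Data.Vec.Base using (Vec; []; _∷_; _++_; head; lookup)
open import Data.Vec.Relation.Binary.Pointwise.Inductive using (Pointwise; []; _∷_)
open import Function.Base using (_∘_)
open import Function.Bundles using (_⇔_; mk⇔)
open import Relation.Binary.Core using (Rel)
open import Relation.Binary.PropositionalEquality.Core using (_≡_)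
open import Relation.Binary.Structures using (IsDenseLinearOrder)
import Relation.Binary.Construct.Add.Extrema.NonStrict as AddExtrema
import Relation.Binary.Construct.StrictToNonStrict as ToNonStrict
open import Relation.Nullary.Construct.Add.Extrema using (_±; [_])
open import Relation.Nullary.Negation.Core using (¬_)
open import Relation.Unary using (Pred; _∈_; _⊆_; _≐_; ∁; _∩_; _∪_)

record Language (s : Level) : Set (lsuc s) where
  field
    FunSym : ℕ → Set s
    RelSym : ℕ → Set s

open Language public

record Structure {s ℓ : Level} (L : Language s) (R : Set ℓ) : Set (s ⊔ lsuc ℓ) where
  field
    fun : ∀ {k} → FunSym L k → Vec R k → R
    rel : ∀ {k} → RelSym L k → Pred (Vec R k) ℓ

open Structure public

data Term {s : Level} (L : Language s) (n : ℕ) : Set s where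
  var : Fin n → Term L n
  app : ∀ {k} → FunSym L k → Vec (Term L n) k → Term L n

-- Variables are de Bruijn indices: a quantifier binds index 0 of its body.
data Formula {s : Level} (L : Language s) : ℕ → Set s where
  _≈′_ : ∀ {n} → Term L n → Term L n → Formula L n
  atom : ∀ {n k} → RelSym L k → Vec (Term L n) k → Formula L n
  ¬′_  : ∀ {n} → Formula L n → Formula L n
  _∧′_ : ∀ {n} → Formula L n → Formula L n → Formula L n
  _∨′_ : ∀ {n} → Formula L n → Formula L n → Formula L n
  ∃′_  : ∀ {n} → Formula L (1 + n) → Formula L n
  ∀′_  : ∀ {n} → Formula L (1 + n) → Formula L n

module _ {s ℓ : Level} {L : Language s} {R : Set ℓ} (M : Structure L R) where

  mutual
    eval : ∀ {n} → Vec R n → Term L n → R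
    eval ρ (var i)    = lookup ρ i
    eval ρ (app f ts) = fun M f (evals ρ ts)

    evals : ∀ {n k} → Vec R n → Vec (Term L n) k → Vec R k
    evals ρ []       = []
    evals ρ (t ∷ ts) = eval ρ t ∷ evals ρ ts

  Sat : ∀ {n} → Formula L n → Pred (Vec R n) ℓ
  Sat (t ≈′ u)    ρ = eval ρ t ≡ eval ρ u
  Sat (atom r ts) ρ = rel M r (evals ρ ts)
  Sat (¬′ φ)      ρ = ¬ Sat φ ρ
  Sat (φ ∧′ ψ)    ρ = Sat φ ρ × Sat ψ ρ
  Sat (φ ∨′ ψ)    ρ = Sat φ ρ ⊎ Sat ψ ρ
  Sat (∃′ φ)      ρ = ∃[ x ] Sat φ (x ∷ ρ)
  Sat (∀′ φ)      ρ = ∀ x → Sat φ (x ∷ ρ)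

  -- Definable with parameters; c is the tuple of parameters.
  Definable : ∀ {n} → Pred (Vec R n) ℓ → Set (s ⊔ ℓ)
  Definable {n} X =
    ∃[ m ] Σ[ φ ∈ Formula L (m + n) ] Σ[ c ∈ Vec R m ]
      (∀ x → x ∈ X ⇔ Sat φ (c ++ x))

-- A subset of R viewed as a subset of R¹.
line : ∀ {ℓ} {R : Set ℓ} → Pred R ℓ → Pred (Vec R 1) ℓ
line X = X ∘ head

record DenseOrder {ℓ : Level} (R : Set ℓ) : Set (lsuc ℓ) where
  infix 4 _<_
  field
    _<_                : Rel R ℓ
    isDenseLinearOrder : IsDenseLinearOrder _≡_ _<_
    noMinimum          : ∀ x → ∃[ y ] y < x
    noMaximum          : ∀ x → ∃[ y ] x < y

  open IsDenseLinearOrder isDenseLinearOrder public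
    using (dense) renaming (trans to <-trans)

module _ {ℓ : Level} {R : Set ℓ} (O : DenseOrder R) where
  open DenseOrder O

  Interval : R → R → Pred R ℓ
  Interval a b x = a < x × x < b

  Box : ∀ {n} → Vec R n → Vec R n → Pred (Vec R n) ℓ
  Box a b x = Pointwise _<_ a x × Pointwise _<_ x b

  -- As there are no endpoints, the bounded open intervals form a base of the
  -- order topology, and the bounded open boxes a base of the product topology.
  IsOpen : ∀ {n} → Pred (Vec R n) ℓ → Set ℓ
  IsOpen U = ∀ x → x ∈ U → ∃[ a ] ∃[ b ] (x ∈ Box a b × Box a b ⊆ U)

  IsClosed : ∀ {n} → Pred (Vec R n) ℓ → Set ℓ
  IsClosed X = IsOpen (∁ X)

  -- Predicates have no extensionality, hence the last constructor.
  data Constructible {n : ℕ} : Pred (Vec R n) ℓ → Set (lsuc ℓ) where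
    open-set     : ∀ {U} → IsOpen U → Constructible U
    complement   : ∀ {X} → Constructible X → Constructible (∁ X)
    intersection : ∀ {X Y} → Constructible X → Constructible Y → Constructible (X ∩ Y)
    union        : ∀ {X Y} → Constructible X → Constructible Y → Constructible (X ∪ Y)
    respects     : ∀ {X Y} → X ≐ Y → Constructible X → Constructible Y

  Discrete : Pred R ℓ → Set ℓ
  Discrete X = ∀ x → x ∈ X →
    ∃[ a ] ∃[ b ] (x ∈ Interval a b × (∀ y → y ∈ X → y ∈ Interval a b → y ≡ x))

  ContainsInterval : Pred R ℓ → Set ℓ
  ContainsInterval X =
    ∃[ a ] ∃[ b ] ((∃[ x ] x ∈ Interval a b) × Interval a b ⊆ X)

  data Piece : Set ℓ where
    point    : R → Piece
    interval : R → R → Piece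

  ⟦_⟧ : Piece → Pred R ℓ
  ⟦ point a      ⟧ x = x ≡ a
  ⟦ interval a b ⟧ x = x ∈ Interval a b

  Union : List Piece → Pred R ℓ
  Union ps x = Any (λ p → x ∈ ⟦ p ⟧) ps

  open AddExtrema (ToNonStrict._≤_ _≡_ _<_) using (_≤±_)

  UpperBound LowerBound : Pred R ℓ → Pred (R ±) ℓ
  UpperBound X u = ∀ x → x ∈ X → [ x ] ≤± u
  LowerBound X l = ∀ x → x ∈ X → l ≤± [ x ]

  IsSupremum IsInfimum : Pred R ℓ → Pred (R ±) ℓ
  IsSupremum X u = UpperBound X u × (∀ v → UpperBound X v → u ≤± v)
  IsInfimum  X l = LowerBound X l × (∀ v → LowerBound X v → v ≤± l)

module _ {s ℓ : Level} {L : Language s} {R : Set ℓ}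
         (O : DenseOrder R) (M : Structure L R) where

  DefinablyComplete : Set (s ⊔ lsuc ℓ)
  DefinablyComplete = (X : Pred R ℓ) → Definable M (line X) →
    (∃[ u ] IsSupremum O X u) × (∃[ l ] IsInfimum O X l)

  LocallyOMinimal : Set (s ⊔ lsuc ℓ)
  LocallyOMinimal = (X : Pred R ℓ) → Definable M (line X) → (a : R) →
    ∃[ b ] ∃[ c ] (a ∈ Interval O b c ×
      (∃[ ps ] (X ∩ Interval O b c) ≐ Union O ps))

  ClosedSetsDiscreteOrInterval : Set (s ⊔ lsuc ℓ)
  ClosedSetsDiscreteOrInterval = (X : Pred R ℓ) →
    Definable M (line X) → IsClosed O (line X) →
    Discrete O X ⊎ ContainsInterval O X

  openCoreLanguage : Language (s ⊔ lsuc ℓ)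
  openCoreLanguage = record
    { FunSym = λ _ → Lift (s ⊔ lsuc ℓ) ⊥
    ; RelSym = λ n → Σ[ U ∈ Pred (Vec R n) ℓ ] (1 ≤ n × Definable M U × IsOpen O U)
    }

  openCore : Structure openCoreLanguage R
  openCore = record
    { fun = λ ()
    ; rel = proj₁
    }

record ExpandsOrder {s ℓ : Level} {L : Language s} {R : Set ℓ}
                    (O : DenseOrder R) (M : Structure L R) : Set (s ⊔ ℓ) where
  open DenseOrder O
  field
    lt     : RelSym L 2
    lt-rel : ∀ x y → rel M lt (x ∷ y ∷ []) ⇔ x < y

record DenseOrderedAbelianGroup {ℓ : Level} (R : Set ℓ) : Set (lsuc ℓ) where
  infixl 6 _⊕_
  field
    order          : DenseOrder R
    _⊕_            : R → R → R
    𝟎              : R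
    ⊖_             : R → R
    isAbelianGroup : IsAbelianGroup _≡_ _⊕_ 𝟎 ⊖_

  open DenseOrder order public

  field
    ⊕-monoʳ-< : ∀ z {x y} → x < y → z ⊕ x < z ⊕ y

record ExpandsGroup {s ℓ : Level} {L : Language s} {R : Set ℓ}
                    (G : DenseOrderedAbelianGroup R) (M : Structure L R) : Set (s ⊔ ℓ) where
  open DenseOrderedAbelianGroup G
  field
    expandsOrder : ExpandsOrder order M
    plus         : FunSym L 2
    plus-fun     : ∀ x y → fun M plus (x ∷ y ∷ []) ≡ x ⊕ y
    zero′        : FunSym L 0
    zero-fun     : fun M zero′ [] ≡ 𝟎

module _ {s ℓ : Level} {L : Language s} {R : Set ℓ}
         {O : DenseOrder R} {M : Structure L R} (E : ExpandsOrder O M) where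
  open DenseOrder O
  open ExpandsOrder E
  open import Data.Fin.Base using (zero; suc)
  open import Function.Bundles using (Equivalence)

  private
    Less : Pred (Vec R 2) ℓ
    Less (x ∷ y ∷ []) = x < y

    less-definable : Definable M Less
    less-definable = 0 , atom lt (var zero ∷ var (suc zero) ∷ []) , [] , λ where
      (x ∷ y ∷ []) → mk⇔ (Equivalence.from (lt-rel x y)) (Equivalence.to (lt-rel x y))

    less-box : ∀ {a b z} → Box O (a ∷ z ∷ []) (z ∷ b ∷ []) ⊆ Less
    less-box {x = u ∷ v ∷ []} ((_ ∷ z<v ∷ []) , (u<z ∷ _ ∷ [])) = <-trans u<z z<v

    less-open : IsOpen O Less
    less-open (x ∷ y ∷ []) x<y
      with z , x<z , z<y ← dense x<y
      with a , a<x ← noMinimum x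
      with b , y<b ← noMaximum y
      = (a ∷ z ∷ []) , (z ∷ b ∷ [])
      , ((a<x ∷ z<y ∷ []) , (x<z ∷ y<b ∷ []))
      , less-box

  openCore-expandsOrder : ExpandsOrder O (openCore O M)
  openCore-expandsOrder = record
    { lt     = Less , s≤s z≤n , less-definable , less-open
    ; lt-rel = λ x y → mk⇔ (λ p → p) (λ p → p)
    }

{-# OPTIONS --safe #-}

-- Call a subset of R sparse if it is closed and discrete. Condition (1) says that a definable closed
-- set without interior is sparse, and it implies that the union of a definable chain of sparse
-- sets is sparse: otherwise a set of record points accumulating at a single point violates (1).
--
-- A Σ-set is a union of a definable family of closed sets F r s, increasing in r and decreasing in
-- s > 0. Finite unions of locally closed definable sets are Σ-sets, and so are projections of
-- Σ-sets. The chain property is a Baire theorem for Σ-sets on the line. By induction on n it extends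
-- to Rⁿ, where moreover a Σ-set without interior is nowhere dense. It follows that the points at
-- which a Σ-set is not locally closed form a Σ-set of smaller dimension, so every Σ-set
-- is a finite boolean combination of definable open sets. Hence these combinations are closed under
-- projection and exhaust the definable sets of the open core. On the line, the boundary of
-- a definable open set is sparse, which gives local o-minimality.
module Submission where

open import Defs
open import Level using (Level; _⊔_) renaming (suc to lsuc)
open import Algebra.Structures using (IsAbelianGroup)
open import Axiom.ExcludedMiddle using (ExcludedMiddle)
open import Data.Empty using (⊥; ⊥-elim)
open import Data.Fin.Base as Fin using (Fin; zero; suc; _↑ˡ_; _↑ʳ_; splitAt)
open import Data.Fin.Properties using (pigeonhole)
open import Data.List.Base as List using (List; []; _∷_)
open import Data.List.Relation.Unary.Any using (here; there)
open import Data.List.Relation.Unary.Any.Properties using (++⁺ˡ; ++⁺ʳ; ++⁻)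
open import Data.Nat.Base using (ℕ; zero; suc; _+_; z≤n; s≤s; s<s)
open import Data.Nat.Properties using (n<1+n)
open import Data.Product.Base using (_×_; _,_; Σ-syntax; ∃-syntax; proj₁; proj₂)
open import Data.Sum.Base using (_⊎_; inj₁; inj₂; [_,_]′)
open import Data.Unit.Polymorphic.Base using (⊤; tt)
open import Data.Vec.Base as Vec using (Vec; []; _∷_; _++_; lookup)
open import Data.Vec.Properties using (lookup-++ˡ; lookup-++ʳ; lookup-splitAt)
open import Data.Vec.Relation.Binary.Pointwise.Inductive using (Pointwise; []; _∷_)
open import Function.Bundles using (_⇔_; mk⇔; Equivalence)
import Relation.Binary.Construct.Add.Extrema.NonStrict as AddExtrema
import Relation.Binary.Construct.Add.Supremum.NonStrict as Supremum
import Relation.Binary.Construct.StrictToNonStrict as ToNonStrict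
open import Relation.Binary.Definitions using (tri<; tri≈; tri>)
open import Relation.Binary.PropositionalEquality
  using (_≡_; refl; sym; trans; cong; cong₂; subst; subst₂)
open import Relation.Binary.Structures using (IsDenseLinearOrder)
open import Relation.Nullary.Construct.Add.Extrema using ([_]; ⊥±; ⊤±)
open import Relation.Nullary.Decidable.Core using (Dec; yes; no)
open import Relation.Nullary.Negation.Core using (¬_)
open import Relation.Unary using (Pred; _≐_)

open Equivalence using (to; from)

-- `R` may have any cofinality and need not be archimedean, so Baire's theorem cannot speak of
-- countable unions: definable families that are monotone in their index take their place. Two
-- indices occur. A bound `r` keeps projections of closed sets closed, by definable compactness of
-- bounded closed boxes; a radius `s` exhausts an open set by closed ones. In a mere ordered group
-- there may be no definable map that turns small radii into large bounds, so the two are not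
-- merged.
--
-- The recurring obstacle is uniformity: a radius that works in the fibre over each single point has
-- to be replaced by one that works over a whole cube of points. `eventually-avoids` achieves this
-- after shrinking the cube, which is why so many statements conclude on a smaller cube and why the
-- step to one more variable draws on both Baire and nowhere density below. The other shrinking
-- device, `bounded-section`, stands in for a continuous choice of points in the fibres.

module OrderedGroup {ℓ : Level} {R : Set ℓ} (em : ExcludedMiddle ℓ)
  (G : DenseOrderedAbelianGroup R) where

  open DenseOrderedAbelianGroup G
  open IsDenseLinearOrder isDenseLinearOrder using (compare; irrefl)
  open IsAbelianGroup isAbelianGroup using (assoc; comm; identityˡ; identityʳ; inverseˡ; inverseʳ)

  by-contradiction : {A : Set ℓ} → ¬ ¬ A → A
  by-contradiction {A} ¬¬a with em {A}
  ... | yes a = a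
  ... | no ¬a = ⊥-elim (¬¬a ¬a)

  -- Inequalities in an ordered abelian group.

  infix 4 _≤_
  -- A negated strict inequality, so that weak inequalities are literally complements of open
  -- conditions.
  _≤_ : R → R → Set ℓ
  x ≤ y = ¬ (y < x)

  <-irrefl : ∀ {x} → ¬ (x < x)
  <-irrefl = irrefl refl

  <-asym : ∀ {x y} → x < y → x ≤ y
  <-asym x<y y<x = <-irrefl (<-trans x<y y<x)

  ≤-refl : ∀ {x} → x ≤ x
  ≤-refl = <-irrefl

  ≤-reflexive : ∀ {x y} → x ≡ y → x ≤ y
  ≤-reflexive refl = ≤-refl

  ≤-or-> : ∀ x y → x ≤ y ⊎ y < x
  ≤-or-> x y with compare x y
  ... | tri< _ _ y≮x = inj₁ y≮x
  ... | tri≈ _ _ y≮x = inj₁ y≮x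
  ... | tri> _ _ y<x = inj₂ y<x

  ≤-<-trans : ∀ {x y z} → x ≤ y → y < z → x < z
  ≤-<-trans {x} {y} x≤y y<z with compare x y
  ... | tri< x<y _ _ = <-trans x<y y<z
  ... | tri≈ _ refl _ = y<z
  ... | tri> _ _ y<x = ⊥-elim (x≤y y<x)

  <-≤-trans : ∀ {x y z} → x < y → y ≤ z → x < z
  <-≤-trans {x} {y} {z} x<y y≤z with compare y z
  ... | tri< y<z _ _ = <-trans x<y y<z
  ... | tri≈ _ refl _ = x<y
  ... | tri> _ _ z<y = ⊥-elim (y≤z z<y)

  ≤-trans : ∀ {x y z} → x ≤ y → y ≤ z → x ≤ z
  ≤-trans x≤y y≤z z<x = x≤y (≤-<-trans y≤z z<x)

  ≤-antisym : ∀ {x y} → x ≤ y → y ≤ x → x ≡ y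
  ≤-antisym {x} {y} x≤y y≤x with compare x y
  ... | tri< x<y _ _ = ⊥-elim (y≤x x<y)
  ... | tri≈ _ x≡y _ = x≡y
  ... | tri> _ _ y<x = ⊥-elim (x≤y y<x)

  ⊕-monoˡ-< : ∀ z {x y} → x < y → x ⊕ z < y ⊕ z
  ⊕-monoˡ-< z {x} {y} x<y = subst₂ _<_ (comm z x) (comm z y) (⊕-monoʳ-< z x<y)

  ⊕-mono-< : ∀ {x y u v} → x < y → u < v → x ⊕ u < y ⊕ v
  ⊕-mono-< {y = y} {u = u} x<y u<v = <-trans (⊕-monoˡ-< u x<y) (⊕-monoʳ-< y u<v)

  ⊕-cancelˡ-< : ∀ z {x y} → z ⊕ x < z ⊕ y → x < y
  ⊕-cancelˡ-< z {x} {y} zx<zy with compare x y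
  ... | tri< x<y _ _ = x<y
  ... | tri≈ _ refl _ = ⊥-elim (<-irrefl zx<zy)
  ... | tri> _ _ y<x = ⊥-elim (<-asym zx<zy (⊕-monoʳ-< z y<x))

  ⊕-cancelʳ-< : ∀ z {x y} → x ⊕ z < y ⊕ z → x < y
  ⊕-cancelʳ-< z {x} {y} xz<yz = ⊕-cancelˡ-< z (subst₂ _<_ (comm x z) (comm y z) xz<yz)

  ⊕-monoʳ-≤ : ∀ z {x y} → x ≤ y → z ⊕ x ≤ z ⊕ y
  ⊕-monoʳ-≤ z x≤y zy<zx = x≤y (⊕-cancelˡ-< z zy<zx)

  ⊕-monoˡ-≤ : ∀ z {x y} → x ≤ y → x ⊕ z ≤ y ⊕ z
  ⊕-monoˡ-≤ z x≤y yz<xz = x≤y (⊕-cancelʳ-< z yz<xz)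

  ⊕-mono-≤ : ∀ {x y u v} → x ≤ y → u ≤ v → x ⊕ u ≤ y ⊕ v
  ⊕-mono-≤ {y = y} {u = u} x≤y u≤v = ≤-trans (⊕-monoˡ-≤ u x≤y) (⊕-monoʳ-≤ y u≤v)

  x<x⊕t : ∀ {x t} → 𝟎 < t → x < x ⊕ t
  x<x⊕t {x} {t} 0<t = subst (_< x ⊕ t) (identityʳ x) (⊕-monoʳ-< x 0<t)

  ⊖-cancelʳ : ∀ x t → (x ⊕ ⊖ t) ⊕ t ≡ x
  ⊖-cancelʳ x t = trans (assoc x (⊖ t) t) (trans (cong (x ⊕_) (inverseˡ t)) (identityʳ x))

  x⊖t<x : ∀ {x t} → 𝟎 < t → x ⊕ ⊖ t < x
  x⊖t<x {x} {t} 0<t = subst (x ⊕ ⊖ t <_) (⊖-cancelʳ x t) (x<x⊕t 0<t)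

  difference : ∀ {x y} → x < y → ∃[ t ] (𝟎 < t × y ≡ x ⊕ t)
  difference {x} {y} x<y = y ⊕ ⊖ x
    , subst (_< y ⊕ ⊖ x) (inverseʳ x) (⊕-monoˡ-< (⊖ x) x<y)
    , trans (sym (⊖-cancelʳ y x)) (comm (y ⊕ ⊖ x) x)

  min₊ : ∀ {t u} → 𝟎 < t → 𝟎 < u → ∃[ w ] (𝟎 < w × w ≤ t × w ≤ u)
  min₊ {t} {u} 0<t 0<u with ≤-or-> t u
  ... | inj₁ t≤u = t , 0<t , ≤-refl , t≤u
  ... | inj₂ u<t = u , 0<u , <-asym u<t , ≤-refl

  upper : ∀ x y → ∃[ z ] (x ≤ z × y ≤ z)
  upper x y with ≤-or-> x y
  ... | inj₁ x≤y = y , x≤y , ≤-refl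
  ... | inj₂ y<x = x , ≤-refl , <-asym y<x

  -- An exact half is not at hand. Cutting `t` at some point strictly between `𝟎` and `t` and taking
  -- the shorter of the two parts gives the inequality.
  halve : ∀ {t} → 𝟎 < t → ∃[ u ] (𝟎 < u × u ⊕ u ≤ t)
  halve 0<t with v , 0<v , v<t ← dense 0<t
            with w , 0<w , refl ← difference v<t
            with u , 0<u , u≤v , u≤w ← min₊ 0<v 0<w
            = u , 0<u , ⊕-mono-≤ u≤v u≤w

  ⊖-anti-< : ∀ {x y} → x < y → ⊖ y < ⊖ x
  ⊖-anti-< {x} {y} x<y = ⊕-cancelʳ-< x
    (subst₂ _<_ refl (trans (inverseˡ y) (sym (inverseˡ x))) (⊕-monoʳ-< (⊖ y) x<y))

  ⊖-involutive : ∀ x → ⊖ ⊖ x ≡ x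
  ⊖-involutive x = trans (sym (identityʳ _)) (trans (cong (⊖ ⊖ x ⊕_) (sym (inverseˡ x)))
    (trans (sym (assoc _ _ _)) (trans (cong (_⊕ x) (inverseˡ (⊖ x))) (identityˡ x))))

  ⊖-anti-≤ : ∀ {x y} → x ≤ y → ⊖ y ≤ ⊖ x
  ⊖-anti-≤ {x} {y} x≤y ⊖x<⊖y =
    x≤y (subst₂ _<_ (⊖-involutive y) (⊖-involutive x) (⊖-anti-< ⊖x<⊖y))

  ⊕-swapʳ : ∀ x y z → (x ⊕ y) ⊕ z ≡ (x ⊕ z) ⊕ y
  ⊕-swapʳ x y z = trans (assoc x y z) (trans (cong (x ⊕_) (comm y z)) (sym (assoc x z y)))

  ⊕-interchange : ∀ x y z w → (x ⊕ y) ⊕ (z ⊕ w) ≡ (x ⊕ z) ⊕ (y ⊕ w)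
  ⊕-interchange x y z w = trans (sym (assoc (x ⊕ y) z w))
    (trans (cong (_⊕ w) (⊕-swapʳ x y z)) (assoc (x ⊕ z) y w))

  ⊖-anti-⊕ : ∀ {x y t} → x < y ⊕ t → ⊖ y < ⊖ x ⊕ t
  ⊖-anti-⊕ {x} {y} {t} x<y⊕t = ⊕-cancelˡ-< (x ⊕ y) (subst₂ _<_
    (sym (trans (assoc x y (⊖ y)) (trans (cong (x ⊕_) (inverseʳ y)) (identityʳ x))))
    (sym (trans (cong (_⊕ (⊖ x ⊕ t)) (comm x y)) (trans (⊕-interchange y x (⊖ x) t) lem))) x<y⊕t)
    where
    lem : (y ⊕ ⊖ x) ⊕ (x ⊕ t) ≡ y ⊕ t
    lem = trans (sym (assoc (y ⊕ ⊖ x) x t)) (cong (_⊕ t) (⊖-cancelʳ y x))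

module DefinableSets {s ℓ : Level} {L : Language s} {R : Set ℓ} (em : ExcludedMiddle ℓ)
  (G : DenseOrderedAbelianGroup R) (M : Structure L R) (E : ExpandsGroup G M)
  (dc : DefinablyComplete (DenseOrderedAbelianGroup.order G) M) where

  open DenseOrderedAbelianGroup G
  open IsAbelianGroup isAbelianGroup using (assoc; comm; identityˡ; identityʳ; inverseˡ; inverseʳ)
  open OrderedGroup em G

  -- Definability calculus on typed tuples.

  -- Contexts are nested products rather than vectors, so that predicates can be written with
  -- pattern-matching lambdas and projections compute.
  data Ty : Set where
    one sc : Ty
    _⊗_    : Ty → Ty → Ty

  infixr 6 _⊗_

  El : Ty → Set ℓ
  El one     = ⊤
  El sc      = R
  El (a ⊗ b) = El a × El b

  size : Ty → ℕ
  size one     = 0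
  size sc      = 1
  size (a ⊗ b) = size a + size b

  enc : ∀ a → El a → Vec R (size a)
  enc one     _       = []
  enc sc      x       = x ∷ []
  enc (a ⊗ b) (x , y) = enc a x ++ enc b y

  pow : ℕ → Ty
  pow zero    = one
  pow (suc n) = sc ⊗ pow n

  toVec : ∀ n → El (pow n) → Vec R n
  toVec zero    _       = []
  toVec (suc n) (x , y) = x ∷ toVec n y

  lift : ∀ {m n} → (Fin m → Fin n) → Fin (suc m) → Fin (suc n)
  lift ρ zero    = zero
  lift ρ (suc i) = suc (ρ i)

  mutual
    renameTerm : ∀ {m n} → (Fin m → Fin n) → Term L m → Term L n
    renameTerm ρ (var i)    = var (ρ i)
    renameTerm ρ (app f ts) = app f (renameTerms ρ ts)

    renameTerms : ∀ {m n k} → (Fin m → Fin n) → Vec (Term L m) k → Vec (Term L n) k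
    renameTerms ρ []       = []
    renameTerms ρ (t ∷ ts) = renameTerm ρ t ∷ renameTerms ρ ts

  rename : ∀ {m n} → (Fin m → Fin n) → Formula L m → Formula L n
  rename ρ (t ≈′ u)    = renameTerm ρ t ≈′ renameTerm ρ u
  rename ρ (atom r ts) = atom r (renameTerms ρ ts)
  rename ρ (¬′ φ)      = ¬′ rename ρ φ
  rename ρ (φ ∧′ ψ)    = rename ρ φ ∧′ rename ρ ψ
  rename ρ (φ ∨′ ψ)    = rename ρ φ ∨′ rename ρ ψ
  rename ρ (∃′ φ)      = ∃′ rename (lift ρ) φ
  rename ρ (∀′ φ)      = ∀′ rename (lift ρ) φ

  -- A record rather than a function type, so that unification can recover `ρ`, `v` and `w` from a
  -- proof.
  record _⊢_≗_ {m n} (ρ : Fin m → Fin n) (v : Vec R n) (w : Vec R m) : Set ℓ where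
    constructor pointwise
    field at : ∀ i → lookup v (ρ i) ≡ lookup w i

  open _⊢_≗_

  lift-≗ : ∀ {m n} {ρ : Fin m → Fin n} {v w} → ρ ⊢ v ≗ w → ∀ x → lift ρ ⊢ (x ∷ v) ≗ (x ∷ w)
  lift-≗ ρ≗ x .at zero    = refl
  lift-≗ ρ≗ x .at (suc i) = at ρ≗ i

  mutual
    eval-rename : ∀ {m n} {ρ : Fin m → Fin n} {v w} → ρ ⊢ v ≗ w → ∀ t →
      eval M v (renameTerm ρ t) ≡ eval M w t
    eval-rename ρ≗ (var i)    = at ρ≗ i
    eval-rename ρ≗ (app f ts) = cong (fun M f) (evals-rename ρ≗ ts)

    evals-rename : ∀ {m n k} {ρ : Fin m → Fin n} {v w} → ρ ⊢ v ≗ w → (ts : Vec _ k) →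
      evals M v (renameTerms ρ ts) ≡ evals M w ts
    evals-rename ρ≗ []       = refl
    evals-rename ρ≗ (t ∷ ts) = cong₂ _∷_ (eval-rename ρ≗ t) (evals-rename ρ≗ ts)

  mutual
    Sat-rename⁺ : ∀ {m n} {ρ : Fin m → Fin n} {v w} → ρ ⊢ v ≗ w → ∀ φ →
      Sat M φ w → Sat M (rename ρ φ) v
    Sat-rename⁺ ρ≗ (t ≈′ u)    p        = trans (eval-rename ρ≗ t) (trans p (sym (eval-rename ρ≗ u)))
    Sat-rename⁺ ρ≗ (atom r ts) p        = subst (rel M r) (sym (evals-rename ρ≗ ts)) p
    Sat-rename⁺ ρ≗ (¬′ φ)      p q      = p (Sat-rename⁻ ρ≗ φ q)
    Sat-rename⁺ ρ≗ (φ ∧′ ψ)    (p , q)  = Sat-rename⁺ ρ≗ φ p , Sat-rename⁺ ρ≗ ψ q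
    Sat-rename⁺ ρ≗ (φ ∨′ ψ)    (inj₁ p) = inj₁ (Sat-rename⁺ ρ≗ φ p)
    Sat-rename⁺ ρ≗ (φ ∨′ ψ)    (inj₂ p) = inj₂ (Sat-rename⁺ ρ≗ ψ p)
    Sat-rename⁺ ρ≗ (∃′ φ)      (x , p)  = x , Sat-rename⁺ (lift-≗ ρ≗ x) φ p
    Sat-rename⁺ ρ≗ (∀′ φ)      p x      = Sat-rename⁺ (lift-≗ ρ≗ x) φ (p x)

    Sat-rename⁻ : ∀ {m n} {ρ : Fin m → Fin n} {v w} → ρ ⊢ v ≗ w → ∀ φ →
      Sat M (rename ρ φ) v → Sat M φ w
    Sat-rename⁻ ρ≗ (t ≈′ u)    p        = trans (sym (eval-rename ρ≗ t)) (trans p (eval-rename ρ≗ u))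
    Sat-rename⁻ ρ≗ (atom r ts) p        = subst (rel M r) (evals-rename ρ≗ ts) p
    Sat-rename⁻ ρ≗ (¬′ φ)      p q      = p (Sat-rename⁺ ρ≗ φ q)
    Sat-rename⁻ ρ≗ (φ ∧′ ψ)    (p , q)  = Sat-rename⁻ ρ≗ φ p , Sat-rename⁻ ρ≗ ψ q
    Sat-rename⁻ ρ≗ (φ ∨′ ψ)    (inj₁ p) = inj₁ (Sat-rename⁻ ρ≗ φ p)
    Sat-rename⁻ ρ≗ (φ ∨′ ψ)    (inj₂ p) = inj₂ (Sat-rename⁻ ρ≗ ψ p)
    Sat-rename⁻ ρ≗ (∃′ φ)      (x , p)  = x , Sat-rename⁻ (lift-≗ ρ≗ x) φ p
    Sat-rename⁻ ρ≗ (∀′ φ)      p x      = Sat-rename⁻ (lift-≗ ρ≗ x) φ (p x)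

  record Def (a : Ty) (P : El a → Set ℓ) : Set (s ⊔ ℓ) where
    constructor mkDef
    field
      {arity}    : ℕ
      formula    : Formula L (arity + size a)
      parameters : Vec R arity
      defines    : ∀ x → P x ⇔ Sat M formula (parameters ++ enc a x)

  resp-d : ∀ {a} {P Q : El a → Set ℓ} → Def a P → (∀ x → P x ⇔ Q x) → Def a Q
  resp-d (mkDef φ c d) P⇔Q = mkDef φ c λ x →
    mk⇔ (λ q → to (d x) (from (P⇔Q x) q)) (λ q → to (P⇔Q x) (from (d x) q))

  ¬d : ∀ {a} {P : El a → Set ℓ} → Def a P → Def a (λ x → ¬ P x)
  ¬d (mkDef φ c d) = mkDef (¬′ φ) c λ x →
    mk⇔ (λ ¬p p → ¬p (from (d x) p)) (λ ¬p p → ¬p (to (d x) p))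

  copair : ∀ {m n k} → (Fin m → Fin k) → (Fin n → Fin k) → Fin (m + n) → Fin k
  copair {m} ρ σ i = [ ρ , σ ]′ (splitAt m i)

  copair-≗ : ∀ {m n k} {ρ : Fin m → Fin k} {σ : Fin n → Fin k} {v w u} →
    ρ ⊢ v ≗ w → σ ⊢ v ≗ u → copair ρ σ ⊢ v ≗ (w ++ u)
  copair-≗ {m} {w = w} {u} ρ≗ σ≗ .at i rewrite lookup-splitAt m w u i with splitAt m i
  ... | inj₁ j = at ρ≗ j
  ... | inj₂ j = at σ≗ j

  ↑ˡ-≗ : ∀ {m n k} {ρ : Fin m → Fin n} {v : Vec R n} {w} → ρ ⊢ v ≗ w → (u : Vec R k) →
    (λ i → ρ i ↑ˡ k) ⊢ (v ++ u) ≗ w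
  ↑ˡ-≗ {ρ = ρ} {v} ρ≗ u .at i = trans (lookup-++ˡ v u (ρ i)) (at ρ≗ i)

  ↑ʳ-≗ : ∀ {m n k} {ρ : Fin m → Fin n} {v : Vec R n} {w} → ρ ⊢ v ≗ w → (u : Vec R k) →
    (λ i → k ↑ʳ ρ i) ⊢ (u ++ v) ≗ w
  ↑ʳ-≗ {ρ = ρ} {v} ρ≗ u .at i = trans (lookup-++ʳ u v (ρ i)) (at ρ≗ i)

  id-≗ : ∀ {m} {v : Vec R m} → (λ i → i) ⊢ v ≗ v
  id-≗ .at i = refl

  -- A conjunction needs both formulas over one tuple of parameters; `ρ` locates the old parameters
  -- inside the new tuple `v`.
  reparametrize : ∀ {a P} (D : Def a P) {m} (v : Vec R m) (ρ : Fin (Def.arity D) → Fin m) →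
    ρ ⊢ v ≗ Def.parameters D →
    Σ[ φ ∈ Formula L (m + size a) ] (∀ x → P x ⇔ Sat M φ (v ++ enc a x))
  reparametrize {a} (mkDef φ c d) {m} v ρ ρ≗ = rename (copair (λ i → ρ i ↑ˡ size a) (m ↑ʳ_)) φ
    , λ x → let σ≗ = copair-≗ (↑ˡ-≗ ρ≗ (enc a x)) (↑ʳ-≗ id-≗ v) in
      mk⇔ (λ p → Sat-rename⁺ σ≗ φ (to (d x) p)) (λ q → from (d x) (Sat-rename⁻ σ≗ φ q))

  infixr 6 _∧d_
  infixr 5 _∨d_
  _∧d_ : ∀ {a} {P Q : El a → Set ℓ} → Def a P → Def a Q → Def a (λ x → P x × Q x)
  _∧d_ {a} D₁ D₂
    with φ , dφ ← reparametrize D₁ (Def.parameters D₁ ++ Def.parameters D₂) (_↑ˡ _) (↑ˡ-≗ id-≗ _)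
    with ψ , dψ ← reparametrize D₂ (Def.parameters D₁ ++ Def.parameters D₂) (_ ↑ʳ_)
                    (↑ʳ-≗ id-≗ (Def.parameters D₁))
    = mkDef (φ ∧′ ψ) _ λ x → mk⇔ (λ (p , q) → to (dφ x) p , to (dψ x) q)
                                 (λ (p , q) → from (dφ x) p , from (dψ x) q)

  _∨d_ : ∀ {a} {P Q : El a → Set ℓ} → Def a P → Def a Q → Def a (λ x → P x ⊎ Q x)
  _∨d_ {a} {P} {Q} D₁ D₂ = resp-d (¬d (¬d D₁ ∧d ¬d D₂))
    (λ x → mk⇔ f (λ { (inj₁ p) (¬p , _) → ¬p p ; (inj₂ q) (_ , ¬q) → ¬q q }))
    where
    f : ∀ {x} → ¬ (¬ P x × ¬ Q x) → P x ⊎ Q x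
    f {x} ¬¬ with em {P x}
    ... | yes p = inj₁ p
    ... | no ¬p = inj₂ (by-contradiction λ ¬q → ¬¬ (¬p , ¬q))

  -- Maps that only rearrange components. Pulling back along them renames variables and adds no
  -- quantifier, so it is available before the general substitution `app-d`.
  data Projection : Ty → Ty → Set where
    idₚ  : ∀ {a} → Projection a a
    !ₚ   : ∀ {a} → Projection a one
    fstₚ : ∀ {a b} → Projection (a ⊗ b) a
    sndₚ : ∀ {a b} → Projection (a ⊗ b) b
    _∘ₚ_ : ∀ {a b c} → Projection b c → Projection a b → Projection a c
    _▵ₚ_ : ∀ {a b c} → Projection a b → Projection a c → Projection a (b ⊗ c)

  ⟦_⟧ₚ : ∀ {a b} → Projection a b → El a → El b
  ⟦ idₚ    ⟧ₚ x = x
  ⟦ !ₚ     ⟧ₚ x = tt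
  ⟦ fstₚ   ⟧ₚ x = proj₁ x
  ⟦ sndₚ   ⟧ₚ x = proj₂ x
  ⟦ f ∘ₚ g ⟧ₚ x = ⟦ f ⟧ₚ (⟦ g ⟧ₚ x)
  ⟦ f ▵ₚ g ⟧ₚ x = ⟦ f ⟧ₚ x , ⟦ g ⟧ₚ x

  index : ∀ {a b} → Projection a b → Fin (size b) → Fin (size a)
  index idₚ              i = i
  index (fstₚ {a} {b})   i = i ↑ˡ size b
  index (sndₚ {a} {b})   i = size a ↑ʳ i
  index (f ∘ₚ g)         i = index g (index f i)
  index (f ▵ₚ g)           = copair (index f) (index g)

  index-≗ : ∀ {a b} (f : Projection a b) x → index f ⊢ enc a x ≗ enc b (⟦ f ⟧ₚ x)
  index-≗ idₚ              x .at i = refl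
  index-≗ (fstₚ {a} {b})   x .at i = lookup-++ˡ (enc a (proj₁ x)) (enc b (proj₂ x)) i
  index-≗ !ₚ               x .at ()
  index-≗ (sndₚ {a} {b})   x .at i = lookup-++ʳ (enc a (proj₁ x)) (enc b (proj₂ x)) i
  index-≗ (f ∘ₚ g)         x .at i = trans (at (index-≗ g x) (index f i)) (at (index-≗ f (⟦ g ⟧ₚ x)) i)
  index-≗ (f ▵ₚ g)         x   = copair-≗ (index-≗ f x) (index-≗ g x)

  project-d : ∀ {a b} {P : El b → Set ℓ} (f : Projection a b) → Def b P → Def a (λ x → P (⟦ f ⟧ₚ x))
  project-d {a} {b} f (mkDef {m} φ c d) =
    mkDef (rename (copair (_↑ˡ size a) (λ i → m ↑ʳ index f i)) φ) c λ x →
      let σ≗ = copair-≗ (↑ˡ-≗ id-≗ (enc a x)) (↑ʳ-≗ (index-≗ f x) c) in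
      mk⇔ (λ p → Sat-rename⁺ σ≗ φ (to (d _) p)) (λ q → from (d _) (Sat-rename⁻ σ≗ φ q))

  ∃sc-d : ∀ {a} {P : El (sc ⊗ a) → Set ℓ} → Def (sc ⊗ a) P → Def a (λ x → ∃[ y ] P (y , x))
  ∃sc-d {a} (mkDef {m} φ c d) =
    mkDef (∃′ rename (copair (λ i → suc (i ↑ˡ size a)) (lift (m ↑ʳ_))) φ) c λ x →
      mk⇔ (λ (y , p) → y , Sat-rename⁺ (σ≗ y x) φ (to (d (y , x)) p))
          (λ (y , q) → y , from (d (y , x)) (Sat-rename⁻ (σ≗ y x) φ q))
    where
    σ≗ : ∀ y x → copair (λ i → suc (i ↑ˡ size a)) (lift (m ↑ʳ_)) ⊢
                   (y ∷ (c ++ enc a x)) ≗ (c ++ (y ∷ enc a x))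
    σ≗ y x = copair-≗ (pointwise (λ i → lookup-++ˡ c (enc a x) i)) (lift-≗ (↑ʳ-≗ id-≗ c) y)

  ∃d : ∀ b {a} {P : El (b ⊗ a) → Set ℓ} → Def (b ⊗ a) P → Def a (λ x → ∃[ y ] P (y , x))
  ∃d one D = resp-d (project-d (!ₚ ▵ₚ idₚ) D) (λ x → mk⇔ (λ p → tt , p) proj₂)
  ∃d sc D = ∃sc-d D
  ∃d (b ⊗ c) D = resp-d
    (∃d b (∃d c (project-d (((fstₚ ∘ₚ sndₚ) ▵ₚ fstₚ) ▵ₚ (sndₚ ∘ₚ sndₚ)) D)))
    (λ x → mk⇔ (λ (y , z , p) → (y , z) , p) (λ ((y , z) , p) → y , z , p))

  ∀d : ∀ b {a} {P : El (b ⊗ a) → Set ℓ} → Def (b ⊗ a) P → Def a (λ x → ∀ y → P (y , x))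
  ∀d b D = resp-d (¬d (∃d b (¬d D)))
    (λ x → mk⇔ (λ ¬∃ y → by-contradiction λ ¬p → ¬∃ (y , ¬p)) (λ p (y , ¬p) → ¬p (p y)))

  infixr 4 _⇒d_
  _⇒d_ : ∀ {a} {P Q : El a → Set ℓ} → Def a P → Def a Q → Def a (λ x → P x → Q x)
  D₁ ⇒d D₂ = resp-d (¬d (D₁ ∧d ¬d D₂))
    (λ x → mk⇔ (λ ¬pq p → by-contradiction λ ¬q → ¬pq (p , ¬q)) (λ pq (p , ¬q) → ¬q (pq p)))

  -- Formulas have no constant for truth and the context may be empty; a universally quantified
  -- reflexivity serves instead.
  true-d : ∀ {a} → Def a (λ _ → ⊤)
  true-d {a} = resp-d (∀d sc (project-d fstₚ eq)) (λ x → mk⇔ (λ _ → tt) (λ _ _ → refl))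
    where
    eq : Def sc (λ x → x ≡ x)
    eq = mkDef (var zero ≈′ var zero) [] λ x → mk⇔ (λ p → p) (λ p → p)

  const-d : ∀ k → Def sc (_≡ k)
  const-d k = mkDef (var (suc zero) ≈′ var zero) (k ∷ []) λ x → mk⇔ (λ p → p) (λ p → p)

  eqsc-d : Def (sc ⊗ sc) (λ (x , y) → x ≡ y)
  eqsc-d = mkDef (var zero ≈′ var (suc zero)) [] λ x → mk⇔ (λ p → p) (λ p → p)

  open ExpandsGroup E
  open ExpandsOrder expandsOrder

  less-d : Def (sc ⊗ sc) (λ (x , y) → x < y)
  less-d = mkDef (atom lt (var zero ∷ var (suc zero) ∷ [])) [] λ (x , y) →
    mk⇔ (from (lt-rel x y)) (to (lt-rel x y))

  plus-d : Def (sc ⊗ (sc ⊗ sc)) (λ (z , x , y) → z ≡ x ⊕ y)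
  plus-d = mkDef (var zero ≈′ app plus (var (suc zero) ∷ var (suc (suc zero)) ∷ [])) [] λ (z , x , y) →
    mk⇔ (λ p → trans p (sym (plus-fun x y))) (λ p → trans p (plus-fun x y))

  eq-d : ∀ a → Def (a ⊗ a) (λ (x , y) → x ≡ y)
  eq-d one = resp-d true-d (λ x → mk⇔ (λ _ → refl) _)
  eq-d sc = eqsc-d
  eq-d (a ⊗ b) = resp-d
    (project-d ((fstₚ ∘ₚ fstₚ) ▵ₚ (fstₚ ∘ₚ sndₚ)) (eq-d a)
     ∧d project-d ((sndₚ ∘ₚ fstₚ) ▵ₚ (sndₚ ∘ₚ sndₚ)) (eq-d b))
    (λ x → mk⇔ (λ (p , q) → cong₂ _,_ p q) (λ p → cong proj₁ p , cong proj₂ p))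

  Definable⇒Def : ∀ {n} {U : Vec R n → Set ℓ} → Definable M U → Def (pow n) (λ x → U (toVec n x))
  Definable⇒Def {n} (m , φ , c , d) =
    mkDef (rename (copair (_↑ˡ size (pow n)) (λ i → m ↑ʳ ρ n i)) φ) c λ x →
      let σ≗ = copair-≗ (↑ˡ-≗ id-≗ (enc (pow n) x)) (↑ʳ-≗ (ρ-≗ n x) c) in
      mk⇔ (λ p → Sat-rename⁺ σ≗ φ (to (d _) p)) (λ q → from (d _) (Sat-rename⁻ σ≗ φ q))
    where
    ρ : ∀ n → Fin n → Fin (size (pow n))
    ρ (suc n) = lift (ρ n)
    ρ-≗ : ∀ n x → ρ n ⊢ enc (pow n) x ≗ toVec n x
    ρ-≗ zero    _       .at ()
    ρ-≗ (suc n) (x , y) = lift-≗ (ρ-≗ n y) x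

  Def⇒Definable : ∀ {P : R → Set ℓ} → Def sc P → Definable M (line P)
  Def⇒Definable (mkDef {m} φ c d) = m , φ , c , λ { (x ∷ []) → d x }

  -- Cubical neighbourhoods and continuous definable maps.

  ⊕-solveˡ : ∀ {x y t} → x ⊕ ⊖ t ≤ y → x ≤ y ⊕ t
  ⊕-solveˡ {x} {y} {t} p = subst (_≤ y ⊕ t) (⊖-cancelʳ x t) (⊕-monoˡ-≤ t p)

  positive : ∃[ e ] 𝟎 < e
  positive = noMaximum 𝟎

  -- Distance less than `t` in the maximum metric, written without subtraction or absolute value.
  Near : ∀ a → R → El a → El a → Set ℓ
  Near one     t x         y         = ⊤
  Near sc      t x         y         = x < y ⊕ t × y < x ⊕ t
  Near (a ⊗ b) t (x₁ , x₂) (y₁ , y₂) = Near a t x₁ y₁ × Near b t x₂ y₂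

  near-refl : ∀ a {t x} → 𝟎 < t → Near a t x x
  near-refl one     0<t = tt
  near-refl sc      0<t = x<x⊕t 0<t , x<x⊕t 0<t
  near-refl (a ⊗ b) 0<t = near-refl a 0<t , near-refl b 0<t

  near-mono : ∀ a {t u x y} → t ≤ u → Near a t x y → Near a u x y
  near-mono one     t≤u _       = tt
  near-mono sc      t≤u (p , q) = <-≤-trans p (⊕-monoʳ-≤ _ t≤u) , <-≤-trans q (⊕-monoʳ-≤ _ t≤u)
  near-mono (a ⊗ b) t≤u (p , q) = near-mono a t≤u p , near-mono b t≤u q

  near-trans : ∀ a {t u x y z} → Near a t x y → Near a u y z → Near a (t ⊕ u) x z
  near-trans one     _ _ = tt
  near-trans sc {t} {u} {x} {y} {z} (p , p′) (q , q′) =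
      <-trans p (subst (y ⊕ t <_) (trans (assoc z u t) (cong (z ⊕_) (comm u t))) (⊕-monoˡ-< t q))
    , <-trans q′ (subst (y ⊕ u <_) (assoc x t u) (⊕-monoˡ-< u p′))
  near-trans (a ⊗ b) (p , p′) (q , q′) = near-trans a p q , near-trans b p′ q′

  near-halves : ∀ a {t u x y z} → u ⊕ u ≤ t → Near a u x y → Near a u y z → Near a t x z
  near-halves a u+u≤t p q = near-mono a u+u≤t (near-trans a p q)

  around : ∀ c {t} → 𝟎 < t →
    ∃[ p ] ∃[ q ] (p < c × c < q × (∀ y → p ≤ y → y ≤ q → Near sc t c y))
  around c 0<t with h , 0<h , h<t ← dense 0<t = c ⊕ ⊖ h , c ⊕ h , x⊖t<x 0<h , x<x⊕t 0<h , λ y p≤y y≤q →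
    ≤-<-trans (⊕-solveˡ p≤y) (⊕-monoʳ-< y h<t) , ≤-<-trans y≤q (⊕-monoʳ-< c h<t)

  within : ∀ {p c q} → p < c → c < q → ∃[ t ] (𝟎 < t × (∀ y → Near sc t c y → p < y × y < q))
  within {p} {c} {q} p<c c<q
    with d₁ , 0<d₁ , refl ← difference p<c
    with d₂ , 0<d₂ , refl ← difference c<q
    with t , 0<t , t≤d₁ , t≤d₂ ← min₊ 0<d₁ 0<d₂ = t , 0<t , λ y (c<y+t , y<c+t) →
      ⊕-cancelʳ-< d₁ (<-≤-trans c<y+t (⊕-monoʳ-≤ y t≤d₁)) , <-≤-trans y<c+t (⊕-monoʳ-≤ c t≤d₂)

  -- Definable continuous maps: substituting them preserves definable, open and closed predicates.
  record Tm (a b : Ty) : Set (s ⊔ ℓ) where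
    field
      map   : El a → El b
      graph : Def (b ⊗ a) (λ (y , x) → y ≡ map x)
      cont  : ∀ x {t} → 𝟎 < t → ∃[ u ] (𝟎 < u × (∀ y → Near a u x y → Near b t (map x) (map y)))

  open Tm using (map; graph; cont)

  app-d : ∀ {a b} {P : El b → Set ℓ} → Def b P → (f : Tm a b) → Def a (λ x → P (map f x))
  app-d {b = b} D f = resp-d (∃d b (graph f ∧d project-d fstₚ D)) λ x →
    mk⇔ (λ { (_ , refl , p) → p }) (λ p → _ , refl , p)

  projection : ∀ {a b} → Projection a b → Tm a b
  projection p .map = ⟦ p ⟧ₚ
  projection p .graph = project-d (fstₚ ▵ₚ (p ∘ₚ sndₚ)) (eq-d _)
  projection p .cont x {t} 0<t = t , 0<t , λ y → near p
    where
    near : ∀ {a b} (p : Projection a b) {x y} → Near a t x y → Near b t (⟦ p ⟧ₚ x) (⟦ p ⟧ₚ y)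
    near idₚ      n = n
    near !ₚ       n = tt
    near fstₚ     n = proj₁ n
    near sndₚ     n = proj₂ n
    near (p ∘ₚ q) n = near p (near q n)
    near (p ▵ₚ q) n = near p n , near q n

  infixr 9 _∘T_
  _∘T_ : ∀ {a b c} → Tm b c → Tm a b → Tm a c
  (f ∘T g) .map x = map f (map g x)
  _∘T_ {b = b} f g .graph = resp-d
    (∃d b (project-d (fstₚ ▵ₚ (sndₚ ∘ₚ sndₚ)) (graph g) ∧d project-d ((fstₚ ∘ₚ sndₚ) ▵ₚ fstₚ) (graph f)))
    λ x → mk⇔ (λ { (_ , refl , p) → p }) (λ p → _ , refl , p)
  (f ∘T g) .cont x 0<t with u , 0<u , f≈ ← cont f (map g x) 0<t
                       with v , 0<v , g≈ ← cont g x 0<u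
                       = v , 0<v , λ y n → f≈ _ (g≈ y n)

  infixr 5 _,T_
  _,T_ : ∀ {a b c} → Tm a b → Tm a c → Tm a (b ⊗ c)
  (f ,T g) .map x = map f x , map g x
  (f ,T g) .graph = resp-d
    (project-d ((fstₚ ∘ₚ fstₚ) ▵ₚ sndₚ) (graph f) ∧d project-d ((sndₚ ∘ₚ fstₚ) ▵ₚ sndₚ) (graph g))
    λ x → mk⇔ (λ { (refl , refl) → refl }) (λ { refl → refl , refl })
  _,T_ {a} f g .cont x 0<t
    with u , 0<u , f≈ ← cont f x 0<t
    with v , 0<v , g≈ ← cont g x 0<t
    with w , 0<w , w≤u , w≤v ← min₊ 0<u 0<v
    = w , 0<w , λ y n → f≈ y (near-mono a w≤u n) , g≈ y (near-mono a w≤v n)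

  constant : ∀ {a b} → El b → Tm a b
  constant k .map _ = k
  constant {b = b} k .graph = project-d fstₚ (eq-k b k)
    where
    eq-k : ∀ b k → Def b (_≡ k)
    eq-k one k = resp-d true-d λ _ → mk⇔ (λ _ → refl) _
    eq-k sc k = const-d k
    eq-k (b ⊗ c) (k , l) = resp-d (project-d fstₚ (eq-k b k) ∧d project-d sndₚ (eq-k c l))
      λ x → mk⇔ (λ { (refl , refl) → refl }) (λ { refl → refl , refl })
  constant {b = b} k .cont x {t} 0<t = t , 0<t , λ _ _ → near-refl b 0<t

  infixl 10 _+T_
  _+T_ : ∀ {a} → Tm a sc → Tm a sc → Tm a sc
  f +T g = sum ∘T (f ,T g)
    where
    sum : Tm (sc ⊗ sc) sc
    sum .map (x , y) = x ⊕ y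
    sum .graph = plus-d
    sum .cont (x , x′) 0<t with u , 0<u , u+u≤t ← halve 0<t =
      u , 0<u , λ (y , y′) ((x<y , y<x) , (x′<y′ , y′<x′)) → add u+u≤t x<y x′<y′ , add u+u≤t y<x y′<x′
      where
      add : ∀ {x y x′ y′ u t} → u ⊕ u ≤ t → x < y ⊕ u → x′ < y′ ⊕ u → x ⊕ x′ < (y ⊕ y′) ⊕ t
      add {x} {y} {x′} {y′} {u} u+u≤t p q = <-≤-trans
        (subst (x ⊕ x′ <_) (⊕-interchange y u y′ u) (⊕-mono-< p q)) (⊕-monoʳ-≤ (y ⊕ y′) u+u≤t)

  -T_ : ∀ {a} → Tm a sc → Tm a sc
  -T f = neg ∘T f
    where
    unique : ∀ {x y} → 𝟎 ≡ y ⊕ x → y ≡ ⊖ x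
    unique {x} {y} p = trans (sym (identityʳ y)) (trans (cong (y ⊕_) (sym (inverseʳ x)))
      (trans (sym (assoc y x (⊖ x))) (trans (cong (_⊕ ⊖ x) (sym p)) (identityˡ (⊖ x)))))
    neg : Tm sc sc
    neg .map = ⊖_
    -- No function symbol for `⊖_` is given: `⊖ x` is defined as the solution `y` of `𝟎 ≡ y ⊕ x`.
    neg .graph = resp-d (app-d plus-d (constant 𝟎 ,T projection idₚ)) λ (y , x) →
      mk⇔ unique λ { refl → sym (inverseˡ x) }
    neg .cont x {t} 0<t = t , 0<t , λ y (p , q) → ⊖-anti-⊕ q , ⊖-anti-⊕ p

  !T : ∀ {a} → Tm a one
  !T = projection !ₚ

  idT : ∀ {a} → Tm a a
  idT = projection idₚ

  -- In a right-nested product, #k is the k-th component and ↓k drops the first k components.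
  #0 : ∀ {a b} → Tm (a ⊗ b) a
  #0 = projection fstₚ

  ↓1 : ∀ {a b} → Tm (a ⊗ b) b
  ↓1 = projection sndₚ

  ↓2 : ∀ {a b c} → Tm (a ⊗ b ⊗ c) c
  ↓2 = projection (sndₚ ∘ₚ sndₚ)

  ↓3 : ∀ {a b c d} → Tm (a ⊗ b ⊗ c ⊗ d) d
  ↓3 = ↓2 ∘T ↓1

  ↓4 : ∀ {a b c d e} → Tm (a ⊗ b ⊗ c ⊗ d ⊗ e) e
  ↓4 = ↓2 ∘T ↓2

  #1 : ∀ {a b c} → Tm (a ⊗ b ⊗ c) b
  #1 = #0 ∘T ↓1

  #2 : ∀ {a b c d} → Tm (a ⊗ b ⊗ c ⊗ d) c
  #2 = #0 ∘T ↓2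

  #3 : ∀ {a b c d e} → Tm (a ⊗ b ⊗ c ⊗ d ⊗ e) d
  #3 = #0 ∘T ↓3

  -- Definable open and closed sets.

  IsOp IsCl : ∀ {a} → (El a → Set ℓ) → Set ℓ
  IsOp {a} P = ∀ x → P x → ∃[ t ] (𝟎 < t × (∀ y → Near a t x y → P y))
  IsCl P = IsOp (λ x → ¬ P x)

  record Op (a : Ty) (P : El a → Set ℓ) : Set (s ⊔ ℓ) where
    constructor mkOp
    field
      def  : Def a P
      nbhd : IsOp P

  record Cl (a : Ty) (P : El a → Set ℓ) : Set (s ⊔ ℓ) where
    constructor mkCl
    field
      def  : Def a P
      nbhd : IsCl P

  module _ {a : Ty} {P Q : El a → Set ℓ} where

    resp-o : Op a P → (∀ x → P x ⇔ Q x) → Op a Q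
    resp-o (mkOp d n) P⇔Q = mkOp (resp-d d P⇔Q) λ x q →
      let t , 0<t , f = n x (from (P⇔Q x) q) in t , 0<t , λ y near → to (P⇔Q y) (f y near)

    resp-c : Cl a P → (∀ x → P x ⇔ Q x) → Cl a Q
    resp-c (mkCl d n) P⇔Q = mkCl (resp-d d P⇔Q) λ x ¬q →
      let t , 0<t , f = n x (λ p → ¬q (to (P⇔Q x) p)) in
      t , 0<t , λ y near q → f y near (from (P⇔Q y) q)

    infixr 6 _∧o_
    infixr 5 _∨o_

    _∧o_ : Op a P → Op a Q → Op a (λ x → P x × Q x)
    mkOp d n ∧o mkOp d′ n′ = mkOp (d ∧d d′) λ x (p , q) →
      let t , 0<t , f = n x p
          u , 0<u , g = n′ x q
          w , 0<w , w≤t , w≤u = min₊ 0<t 0<u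
      in w , 0<w , λ y near → f y (near-mono a w≤t near) , g y (near-mono a w≤u near)

    _∨o_ : Op a P → Op a Q → Op a (λ x → P x ⊎ Q x)
    mkOp d n ∨o mkOp d′ n′ = mkOp (d ∨d d′) λ where
      x (inj₁ p) → let t , 0<t , f = n x p in t , 0<t , λ y near → inj₁ (f y near)
      x (inj₂ q) → let t , 0<t , f = n′ x q in t , 0<t , λ y near → inj₂ (f y near)

  ¬o : ∀ {a} {P : El a → Set ℓ} → Cl a P → Op a (λ x → ¬ P x)
  ¬o (mkCl d n) = mkOp (¬d d) n

  ¬c : ∀ {a} {P : El a → Set ℓ} → Op a P → Cl a (λ x → ¬ P x)
  ¬c (mkOp d n) = mkCl (¬d d) λ x ¬¬p →
    let t , 0<t , f = n x (by-contradiction ¬¬p) in t , 0<t , λ y near ¬p → ¬p (f y near)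

  module _ {a : Ty} {P Q : El a → Set ℓ} where

    infixr 6 _∧c_
    infixr 4 _⇒c_

    _∧c_ : Cl a P → Cl a Q → Cl a (λ x → P x × Q x)
    p ∧c q = resp-c (¬c (¬o p ∨o ¬o q)) λ x → mk⇔
      (λ n → by-contradiction (λ ¬p → n (inj₁ ¬p)) , by-contradiction (λ ¬q → n (inj₂ ¬q)))
      λ { (p , q) (inj₁ ¬p) → ¬p p ; (p , q) (inj₂ ¬q) → ¬q q }

    _⇒c_ : Op a P → Cl a Q → Cl a (λ x → P x → Q x)
    p ⇒c q = resp-c (¬c (p ∧o ¬o q)) λ x → mk⇔
      (λ n p → by-contradiction λ ¬q → n (p , ¬q)) (λ f (p , ¬q) → ¬q (f p))

  app-o : ∀ {a b} {P : El b → Set ℓ} → Op b P → (f : Tm a b) → Op a (λ x → P (map f x))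
  app-o (mkOp d n) f = mkOp (app-d d f) λ x p →
    let t , 0<t , g = n (map f x) p
        u , 0<u , h = cont f x 0<t
    in u , 0<u , λ y near → g _ (h y near)

  app-c : ∀ {a b} {P : El b → Set ℓ} → Cl b P → (f : Tm a b) → Cl a (λ x → P (map f x))
  app-c (mkCl d n) f = mkCl (app-d d f) (Op.nbhd (app-o (mkOp (¬d d) n) f))

  -- An intersection of closed sets is closed, so it is enough to control `x` for each fixed `y`.
  ∀sections-c : ∀ b {a} {P : El (b ⊗ a) → Set ℓ} →
    Def (b ⊗ a) P → (∀ y → IsCl (λ x → P (y , x))) → Cl a (λ x → ∀ y → P (y , x))
  ∀sections-c b {P = P} d n = mkCl (∀d b d) λ x ¬∀ →
    let y , ¬p = by-contradiction (λ ¬∃ → ¬∀ λ y → by-contradiction λ ¬p → ¬∃ (y , ¬p))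
        t , 0<t , f = n y x ¬p
    in t , 0<t , λ z near p → f z near (p y)

  ∀c : ∀ b {a} {P : El (b ⊗ a) → Set ℓ} → Cl (b ⊗ a) P → Cl a (λ x → ∀ y → P (y , x))
  ∀c b (mkCl d n) = ∀sections-c b d λ y x ¬p →
    let t , 0<t , f = n (y , x) ¬p in t , 0<t , λ z near → f (y , z) (near-refl b 0<t , near)

  infix 7 _<o_ _≤c_ _≡c_
  _<o_ : ∀ {a} (f g : Tm a sc) → Op a (λ x → map f x < map g x)
  f <o g = app-o (mkOp less-d open-less) (f ,T g)
    where
    open-less : IsOp {sc ⊗ sc} (λ (x , y) → x < y)
    open-less (x , y) x<y
      with d , 0<d , refl ← difference x<y
      with u , 0<u , u+u≤d ← halve 0<d
      = u , 0<u , λ (x′ , y′) ((_ , x′<x) , (y<y′ , _)) → ⊕-cancelʳ-< u (<-trans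
          (<-≤-trans (⊕-monoˡ-< u x′<x) (≤-trans (≤-reflexive (assoc x u u)) (⊕-monoʳ-≤ x u+u≤d))) y<y′)

  _≤c_ : ∀ {a} (f g : Tm a sc) → Cl a (λ x → map f x ≤ map g x)
  f ≤c g = ¬c (g <o f)

  _≡c_ : ∀ {a b} (f g : Tm a b) → Cl a (λ x → map f x ≡ map g x)
  _≡c_ {b = b} f g = app-c (diagonal b) (f ,T g)
    where
    diagonal : ∀ b → Cl (b ⊗ b) (λ (x , y) → x ≡ y)
    diagonal one = mkCl (eq-d one) λ x ¬p → ⊥-elim (¬p refl)
    diagonal sc = resp-c (#0 ≤c ↓1 ∧c ↓1 ≤c #0) λ x →
      mk⇔ (λ (p , q) → ≤-antisym p q) λ { refl → ≤-refl , ≤-refl }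
    diagonal (b ⊗ c) = resp-c
      (app-c (diagonal b) (#0 ∘T #0 ,T #0 ∘T ↓1) ∧c app-c (diagonal c) (↓1 ∘T #0 ,T ↓1 ∘T ↓1))
      λ x → mk⇔ (λ { (refl , refl) → refl }) (λ { refl → refl , refl })

  near-o : ∀ {a} b (t : Tm a sc) (f g : Tm a b) → Op a (λ x → Near b (map t x) (map f x) (map g x))
  near-o one     t f g = mkOp true-d λ x _ → let e , 0<e = positive in e , 0<e , _
  near-o sc      t f g = (f <o g +T t) ∧o (g <o f +T t)
  near-o (b ⊗ c) t f g = near-o b t (#0 ∘T f) (#0 ∘T g) ∧o near-o c t (↓1 ∘T f) (↓1 ∘T g)

  Def-near : ∀ {a} b (t : Tm a sc) (f g : Tm a b) → Def a (λ x → Near b (map t x) (map f x) (map g x))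
  Def-near b t f g = Op.def (near-o b t f g)

  infix 7 _<d_ _≤d_
  _<d_ : ∀ {a} (f g : Tm a sc) → Def a (λ x → map f x < map g x)
  f <d g = Op.def (f <o g)

  _≤d_ : ∀ {a} (f g : Tm a sc) → Def a (λ x → map f x ≤ map g x)
  f ≤d g = Cl.def (f ≤c g)

  near-c : ∀ a c t → IsOp (Near a t c)
  near-c a c t = Op.nbhd (near-o a (constant {a} t) (constant c) idT)

  Int : ∀ {a} → (El a → Set ℓ) → El a → Set ℓ
  Int {a} P x = ∃[ t ] (𝟎 < t × (∀ y → Near a t x y → P y))

  Int-d : ∀ a {b} {P : El (b ⊗ a) → Set ℓ} → Def (b ⊗ a) P →
    Def (b ⊗ a) (λ (y , x) → Int (λ z → P (y , z)) x)
  Int-d a D = ∃d sc (constant 𝟎 <d #0 ∧d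
    ∀d a (Def-near a #1 ↓3 #0 ⇒d app-d D (#2 ,T #0)))

  Int-open : ∀ {a} {P : El a → Set ℓ} → IsOp (Int P)
  Int-open {a} x (t , 0<t , f) with u , 0<u , u+u≤t ← halve 0<t =
    u , 0<u , λ y near → u , 0<u , λ z near′ → f z (near-halves a u+u≤t near near′)

  Int-o : ∀ {a} {P : El a → Set ℓ} → Def a P → Op a (Int P)
  Int-o {a} D = mkOp (app-d (Int-d a {one} (app-d D ↓1)) (!T ,T idT)) Int-open

  HasInt : ∀ a → (El a → Set ℓ) → Set ℓ
  HasInt a P = ∃[ c ] Int {a} P c

  -- Definable completeness: suprema, interval induction, compactness.

  private
    module ± = AddExtrema (ToNonStrict._≤_ _≡_ _<_)

  ≤⇒≤± : ∀ {x y} → x ≤ y → [ x ] ±.≤± [ y ]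
  ≤⇒≤± {x} {y} x≤y with IsDenseLinearOrder.compare isDenseLinearOrder x y
  ... | tri< p _ _ = ±.[ inj₁ p ]
  ... | tri≈ _ p _ = ±.[ inj₂ p ]
  ... | tri> _ _ p = ⊥-elim (x≤y p)

  ≤±⇒≤ : ∀ {x y} → [ x ] ±.≤± [ y ] → x ≤ y
  ≤±⇒≤ p with ±.[≤]-injective p
  ... | inj₁ x<y  = <-asym x<y
  ... | inj₂ refl = ≤-refl

  -- Definable completeness allows infinite values; the member `x₀` and the bound `b` exclude them.
  supremum : ∀ {P : R → Set ℓ} → Def sc P → ∀ {x₀ b} → P x₀ → (∀ x → P x → x ≤ b) →
    ∃[ m ] ((∀ x → P x → x ≤ m) × (∀ u → u < m → ∃[ x ] (P x × u < x)))
  supremum {P} D {x₀} {b} Px₀ ≤b with proj₁ (dc P (Def⇒Definable D))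
  ... | ⊥± , up , _ = ⊥-elim (absurd (up x₀ Px₀))
    where
    absurd : ∀ {x} → [ x ] ±.≤± ⊥± → ⊥
    absurd Supremum.[ () ]
  ... | ⊤± , _ , least = ⊥-elim (absurd (least [ b ] (λ x p → ≤⇒≤± (≤b x p))))
    where
    absurd : ∀ {x} → ⊤± ±.≤± [ x ] → ⊥
    absurd ()
  ... | [ m ] , up , least = m , (λ x p → ≤±⇒≤ (up x p)) , λ u u<m → by-contradiction λ ¬∃ →
    ≤±⇒≤ (least [ u ] (λ x p → ≤⇒≤± (λ u<x → ¬∃ (x , p , u<x)))) u<m

  infimum : ∀ {P : R → Set ℓ} → Def sc P → ∀ {x₀ b} → P x₀ → (∀ x → P x → b ≤ x) →
    ∃[ m ] ((∀ x → P x → m ≤ x) × (∀ u → m < u → ∃[ x ] (P x × x < u)))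
  infimum {P} D {x₀} {b} Px₀ b≤ with proj₂ (dc P (Def⇒Definable D))
  ... | ⊤± , low , _ = ⊥-elim (absurd (low x₀ Px₀))
    where
    absurd : ∀ {x} → ⊤± ±.≤± [ x ] → ⊥
    absurd ()
  ... | ⊥± , _ , greatest = ⊥-elim (absurd (greatest [ b ] (λ x p → ≤⇒≤± (b≤ x p))))
    where
    absurd : ∀ {x} → [ x ] ±.≤± ⊥± → ⊥
    absurd Supremum.[ () ]
  ... | [ m ] , low , greatest = m , (λ x p → ≤±⇒≤ (low x p)) , λ u m<u → by-contradiction λ ¬∃ →
    ≤±⇒≤ (greatest [ u ] (λ x p → ≤⇒≤± (λ x<u → ¬∃ (x , p , x<u)))) m<u

  -- Definable compactness of a closed interval, with `Q u v` read as a property of the segment from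
  -- `u` to `v`. At the supremum `m` of the right ends reached from `a`, the local hypothesis glues
  -- on a segment ending at some `q` beyond `m`; so `q` cannot lie below `b`.
  interval-induction : (Q : R → R → Set ℓ) → Def (sc ⊗ sc) (λ (u , v) → Q u v) →
    (∀ {u v u′ v′} → u ≤ u′ → v′ ≤ v → Q u v → Q u′ v′) →
    (∀ {u v w} → u ≤ v → v ≤ w → Q u v → Q v w → Q u w) →
    ∀ {a b} → a ≤ b →
    (∀ c → a ≤ c → c ≤ b → ∃[ p ] ∃[ q ] (p < c × c < q × Q p q)) → Q a b
  interval-induction Q D shrink glue {a} {b} a≤b local
    = [ (λ b≤q → shrink ≤-refl b≤q Qaq)
      , (λ q<b → ⊥-elim (≤m q (≤-trans a≤v v≤q , <-asym q<b , Qaq) m<q)) ]′ (≤-or-> b q)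
    where
    S : R → Set ℓ
    S v = a ≤ v × v ≤ b × Q a v
    Sa : S a
    Sa = let p , q , p<a , a<q , Qpq = local a ≤-refl a≤b in
         ≤-refl , a≤b , shrink (<-asym p<a) (<-asym a<q) Qpq
    sup : ∃[ m ] ((∀ x → S x → x ≤ m) × (∀ u → u < m → ∃[ x ] (S x × u < x)))
    sup = supremum (constant a ≤d idT ∧d idT ≤d constant b ∧d app-d D (constant a ,T idT))
      Sa (λ v (_ , v≤b , _) → v≤b)
    m = proj₁ sup
    ≤m = proj₁ (proj₂ sup)
    approx = proj₂ (proj₂ sup)
    m≤b : m ≤ b
    m≤b b<m = let v , (_ , v≤b , _) , b<v = approx b b<m in v≤b b<v
    neighbourhood = local m (≤m a Sa) m≤b
    p = proj₁ neighbourhood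
    q = proj₁ (proj₂ neighbourhood)
    m<q = proj₁ (proj₂ (proj₂ (proj₂ neighbourhood)))
    witness = approx p (proj₁ (proj₂ (proj₂ neighbourhood)))
    v = proj₁ witness
    a≤v = proj₁ (proj₁ (proj₂ witness))
    v≤q : v ≤ q
    v≤q = ≤-trans (≤m v (proj₁ (proj₂ witness))) (<-asym m<q)
    Qaq : Q a q
    Qaq = glue a≤v v≤q (proj₂ (proj₂ (proj₁ (proj₂ witness))))
      (shrink (<-asym (proj₂ (proj₂ witness))) ≤-refl (proj₂ (proj₂ (proj₂ (proj₂ neighbourhood)))))

  -- The tube lemma: over a point outside the projection every height has a neighbourhood that
  -- avoids `K`, and interval induction makes the radius uniform in the height.
  ∃≤c : ∀ {a} {P : El (sc ⊗ a) → Set ℓ} → Cl (sc ⊗ a) P → (lo hi : Tm a sc) →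
    Cl a (λ x → ∃[ y ] ((map lo x ≤ y × y ≤ map hi x) × P (y , x)))
  ∃≤c {a} {P} C lo hi = mkCl (∃d sc (Cl.def K)) closed
    where
    K : Cl (sc ⊗ a) (λ (y , x) → (map lo x ≤ y × y ≤ map hi x) × P (y , x))
    K = (lo ∘T ↓1 ≤c #0 ∧c #0 ≤c hi ∘T ↓1) ∧c C

    KP : El (sc ⊗ a) → Set ℓ
    KP (y , x) = (map lo x ≤ y × y ≤ map hi x) × P (y , x)

    closed : IsCl (λ x → ∃[ y ] ((map lo x ≤ y × y ≤ map hi x) × P (y , x)))
    closed x ¬∃ = conclude
      where
      e′ = proj₁ positive
      0<e′ = proj₂ positive
      -- The ends `lo` and `hi` move with `x`, so the tube is built over a longer interval. The
      -- excess `e′` is arbitrary; continuity keeps the moved ends inside.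
      a₀ = map lo x ⊕ ⊖ e′
      b₀ = map hi x ⊕ e′
      Q : R → R → Set ℓ
      Q u v = ∃[ t ] (𝟎 < t × (∀ y → u ≤ y → y ≤ v → ∀ x′ → Near a t x x′ → ¬ KP (y , x′)))
      Q-d : Def (sc ⊗ sc) (λ (u , v) → Q u v)
      Q-d = ∃d sc (constant 𝟎 <d #0 ∧d ∀d sc (#2 ≤d #0 ⇒d #0 ≤d ↓3 ⇒d
        ∀d a (Def-near a #2 (constant x) #0 ⇒d ¬d (app-d (Cl.def K) (#1 ,T #0)))))
      tube : Q a₀ b₀
      tube with ≤-or-> a₀ b₀
      ... | inj₂ b₀<a₀ = e′ , proj₂ positive , λ y a₀≤y y≤b₀ → ⊥-elim (≤-trans a₀≤y y≤b₀ b₀<a₀)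
      ... | inj₁ a₀≤b₀ = interval-induction Q Q-d
        (λ u≤ ≤v (t , 0<t , f) → t , 0<t , λ y p q → f y (≤-trans u≤ p) (≤-trans q ≤v))
        glue a₀≤b₀ local
        where
        glue : ∀ {u v w} → u ≤ v → v ≤ w → Q u v → Q v w → Q u w
        glue {v = v} _ _ (t , 0<t , f) (t′ , 0<t′ , f′) =
          let w , 0<w , w≤t , w≤t′ = min₊ 0<t 0<t′ in
          w , 0<w , λ y p q x′ near → [ (λ y≤v → f y p y≤v x′ (near-mono a w≤t near))
                                     , (λ v<y → f′ y (<-asym v<y) q x′ (near-mono a w≤t′ near)) ]′ (≤-or-> y v)
        local : ∀ c → a₀ ≤ c → c ≤ b₀ → ∃[ p ] ∃[ q ] (p < c × c < q × Q p q)
        local c _ _ =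
          let t , 0<t , f = Cl.nbhd K (c , x) (λ k → ¬∃ (c , k))
              p , q , p<c , c<q , near = around c 0<t
          in p , q , p<c , c<q , t , 0<t , λ y p≤y y≤q x′ near′ → f (y , x′) (near y p≤y y≤q , near′)
      conclude : ∃[ t ] (𝟎 < t × (∀ x′ → Near a t x x′ → ¬ (∃[ y ] KP (y , x′))))
      conclude =
        let t₁ , 0<t₁ , lo≈ = cont lo x 0<e′
            t₂ , 0<t₂ , hi≈ = cont hi x 0<e′
            t₃ , 0<t₃ , avoids = tube
            t , 0<t , t≤t₁ , t≤t₂ = min₊ 0<t₁ 0<t₂
            u , 0<u , u≤t , u≤t₃ = min₊ 0<t 0<t₃
        in u , 0<u , λ x′ near (y , (lo≤y , y≤hi) , p) → avoids y
            (λ y<lo → lo≤y (⊕-cancelʳ-< e′ (<-trans (⊕-monoˡ-< e′ y<lo)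
              (subst (_< map lo x′ ⊕ e′) (sym (⊖-cancelʳ _ e′))
                (proj₁ (lo≈ x′ (near-mono a (≤-trans u≤t t≤t₁) near)))))))
            (≤-trans y≤hi (<-asym (proj₂ (hi≈ x′ (near-mono a (≤-trans u≤t t≤t₂) near)))))
            x′ (near-mono a u≤t₃ near) ((lo≤y , y≤hi) , p)

  Bdd : ∀ a → R → El a → Set ℓ
  Bdd one     r x       = ⊤
  Bdd sc      r x       = ⊖ r ≤ x × x ≤ r
  Bdd (a ⊗ b) r (x , y) = Bdd a r x × Bdd b r y

  Bdd-mono : ∀ a {r r′ x} → r ≤ r′ → Bdd a r x → Bdd a r′ x
  Bdd-mono one     r≤ _       = tt
  Bdd-mono sc      r≤ (p , q) = ≤-trans (⊖-anti-≤ r≤) p , ≤-trans q r≤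
  Bdd-mono (a ⊗ b) r≤ (p , q) = Bdd-mono a r≤ p , Bdd-mono b r≤ q

  bounded : ∀ a x → ∃[ r ] Bdd a r x
  bounded one     _ = 𝟎 , tt
  bounded sc      x with r , x≤r , ⊖x≤r ← upper x (⊖ x) =
    r , subst (⊖ r ≤_) (⊖-involutive x) (⊖-anti-≤ ⊖x≤r) , x≤r
  bounded (a ⊗ b) (x , y)
    with r , x≤r ← bounded a x
    with r′ , y≤r′ ← bounded b y
    with m , r≤m , r′≤m ← upper r r′ = m , Bdd-mono a r≤m x≤r , Bdd-mono b r′≤m y≤r′

  Bdd-c : ∀ {a} b (r : Tm a sc) (f : Tm a b) → Cl a (λ x → Bdd b (map r x) (map f x))
  Bdd-c one     r f = mkCl true-d λ x ¬⊤ → ⊥-elim (¬⊤ tt)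
  Bdd-c sc      r f = (-T r) ≤c f ∧c f ≤c r
  Bdd-c (b ⊗ c) r f = Bdd-c b r (#0 ∘T f) ∧c Bdd-c c r (↓1 ∘T f)

  ∃Bddc : ∀ b {a} {P : El (b ⊗ a) → Set ℓ} → Cl (b ⊗ a) P → (r : Tm a sc) →
    Cl a (λ x → ∃[ y ] (Bdd b (map r x) y × P (y , x)))
  ∃Bddc one     C r = resp-c (app-c C (!T ,T idT)) λ x → mk⇔ (λ p → tt , tt , p) (λ (_ , _ , p) → p)
  ∃Bddc sc      C r = ∃≤c C (-T r) r
  ∃Bddc (b ⊗ c) {a} {P} C r = resp-c
    (∃Bddc b {P = λ (y , x) → ∃[ z ] (Bdd c (map r x) z × P ((y , z) , x))}
      (∃Bddc c (app-c C ((#1 ,T #0) ,T ↓2)) (r ∘T ↓1)) r)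
    λ x → mk⇔ (λ (y , y≤ , z , z≤ , p) → (y , z) , (y≤ , z≤) , p)
              (λ ((y , z) , (y≤ , z≤) , p) → y , y≤ , z , z≤ , p)

  -- From local o-minimality of the open core to condition (1).

  -- The complement of a closed definable set is a relation of the open core, so the set itself is
  -- definable there. If it contains no interval, only finitely many points of it are left near any
  -- given one.
  locallyOMinimal⇒closedSets : LocallyOMinimal order (openCore order M) → ClosedSetsDiscreteOrInterval order M
  locallyOMinimal⇒closedSets lom X (m , φ , c , d) closed with em {ContainsInterval order X}
  ... | yes found = inj₂ found
  ... | no ¬interval = inj₁ λ x Xx → isolate x (lom X core-definable x)
    where
    core-definable : Definable (openCore order M) (line X)
    core-definable = 0 , ¬′ atom (_ , s≤s z≤n , (m , ¬′ φ , c , complement-defined) , closed) (var zero ∷ []) , [] , λ where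
        (x ∷ []) → mk⇔ (λ Xx ¬Xx → ¬Xx Xx) by-contradiction
      where
      complement-defined : ∀ x → (¬ line X x) ⇔ (¬ Sat M φ (c ++ x))
      complement-defined x = mk⇔ (λ ¬Xx p → ¬Xx (from (d x) p)) (λ ¬p Xx → ¬p (to (d x) Xx))

    isolated : ∀ x ps → (∀ y → Union order ps y → X y) →
      ∃[ t ] (𝟎 < t × (∀ y → Union order ps y → Near sc t x y → y ≡ x))
    isolated x [] _ = let e , 0<e = positive in e , 0<e , λ _ ()
    isolated x (p ∷ ps) ⊆X = let t , 0<t , f = isolated x ps (λ y u → ⊆X y (there u)) in piece p t 0<t f ⊆X
      where
      piece : ∀ p t → 𝟎 < t → (∀ y → Union order ps y → Near sc t x y → y ≡ x) →
        (∀ y → Union order (p ∷ ps) y → X y) →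
        ∃[ t ] (𝟎 < t × (∀ y → Union order (p ∷ ps) y → Near sc t x y → y ≡ x))
      piece (interval a b) t 0<t f ⊆X = t , 0<t , λ where
        -- An interval piece with a point in it would be an interval inside `X`.
        y (here y∈ab) _ → ⊥-elim (¬interval (a , b , (y , y∈ab) , λ {z} z∈ab → ⊆X z (here z∈ab)))
        y (there u) near → f y u near
      piece (point a) t 0<t f ⊆X with IsDenseLinearOrder.compare isDenseLinearOrder a x
      ... | tri≈ _ refl _ = t , 0<t , λ { y (here y≡x) _ → y≡x ; y (there u) near → f y u near }
      ... | tri< a<x _ _ =
        let u , 0<u , g = within a<x (x<x⊕t 0<t)
            w , 0<w , w≤t , w≤u = min₊ 0<t 0<u
        in w , 0<w , λ where
             y (here refl) near → ⊥-elim (<-irrefl (proj₁ (g y (near-mono sc w≤u near))))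
             y (there v) near → f y v (near-mono sc w≤t near)
      ... | tri> _ _ x<a =
        let u , 0<u , g = within (x⊖t<x 0<t) x<a
            w , 0<w , w≤t , w≤u = min₊ 0<t 0<u
        in w , 0<w , λ where
             y (here refl) near → ⊥-elim (<-irrefl (proj₂ (g y (near-mono sc w≤u near))))
             y (there v) near → f y v (near-mono sc w≤t near)

    isolate : ∀ x → ∃[ b ] ∃[ c ] (Interval order b c x ×
        ∃[ ps ] ((λ y → X y × Interval order b c y) ≐ Union order ps)) →
      ∃[ p ] ∃[ q ] (Interval order p q x × (∀ y → X y → Interval order p q y → y ≡ x))
    isolate x (b , c , (b<x , x<c) , ps , to-ps , from-ps) =
      let t , 0<t , f = isolated x ps (λ y u → proj₁ (from-ps u))
          u , 0<u , g = within b<x x<c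
          w , 0<w , w≤t , w≤u = min₊ 0<t 0<u
      in x ⊕ ⊖ w , x ⊕ w , (x⊖t<x 0<w , x<x⊕t 0<w) , λ y Xy (l , h) →
           let near = subst (_< y ⊕ w) (⊖-cancelʳ x w) (⊕-monoˡ-< w l) , h in
           f y (to-ps (Xy , g y (near-mono sc w≤u near))) (near-mono sc w≤t near)

  module ClosedSets (h : ClosedSetsDiscreteOrInterval order M) where

    -- Translation between boxes of vectors and cubes of tuples.

    fromVec : ∀ {n} → Vec R n → El (pow n)
    fromVec []       = tt
    fromVec (x ∷ xs) = x , fromVec xs

    toVec-fromVec : ∀ {n} (v : Vec R n) → toVec n (fromVec v) ≡ v
    toVec-fromVec []       = refl
    toVec-fromVec (x ∷ xs) = cong (x ∷_) (toVec-fromVec xs)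

    IsOpen⇒IsOp : ∀ {n} {U : Vec R n → Set ℓ} → IsOpen order U → IsOp (λ x → U (toVec n x))
    IsOpen⇒IsOp {n} open-U x Ux =
      let a , b , (a<x , x<b) , box⊆U = open-U (toVec n x) Ux
          t , 0<t , f = cube n a b x a<x x<b
      in t , 0<t , λ y near → box⊆U (f y near)
      where
      cube : ∀ n a b x → Pointwise _<_ a (toVec n x) → Pointwise _<_ (toVec n x) b →
        ∃[ t ] (𝟎 < t × (∀ y → Near (pow n) t x y → Box order a b (toVec n y)))
      cube zero [] [] _ _ _ = let e , 0<e = positive in e , 0<e , λ _ _ → [] , []
      cube (suc n) (a ∷ as) (b ∷ bs) (x , xs) (a<x ∷ as<xs) (x<b ∷ xs<bs) =
        let t , 0<t , f = within a<x x<b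
            u , 0<u , g = cube n as bs xs as<xs xs<bs
            w , 0<w , w≤t , w≤u = min₊ 0<t 0<u
        in w , 0<w , λ (y , ys) (near , nears) →
          let a<y , y<b = f y (near-mono sc w≤t near)
              as<ys , ys<bs = g ys (near-mono (pow n) w≤u nears)
          in a<y ∷ as<ys , y<b ∷ ys<bs

    IsOp⇒IsOpen : ∀ {n} {U : Vec R n → Set ℓ} → IsOp (λ x → U (toVec n x)) → IsOpen order U
    IsOp⇒IsOpen {n} {U} open-U v Uv =
      let t , 0<t , f = open-U (fromVec v) (subst U (sym (toVec-fromVec v)) Uv)
      in below t v , above t v , (below-< 0<t v , <-above 0<t v) ,
         λ {w} (l , u) → subst U (toVec-fromVec w) (f (fromVec w) (near v w l u))
      where
      below above : ∀ {n} → R → Vec R n → Vec R n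
      below t []       = []
      below t (x ∷ xs) = x ⊕ ⊖ t ∷ below t xs
      above t []       = []
      above t (x ∷ xs) = x ⊕ t ∷ above t xs
      below-< : ∀ {n t} → 𝟎 < t → (v : Vec R n) → Pointwise _<_ (below t v) v
      below-< 0<t []       = []
      below-< 0<t (x ∷ xs) = x⊖t<x 0<t ∷ below-< 0<t xs
      <-above : ∀ {n t} → 𝟎 < t → (v : Vec R n) → Pointwise _<_ v (above t v)
      <-above 0<t []       = []
      <-above 0<t (x ∷ xs) = x<x⊕t 0<t ∷ <-above 0<t xs
      near : ∀ {n t} (v w : Vec R n) → Pointwise _<_ (below t v) w → Pointwise _<_ w (above t v) →
        Near (pow n) t (fromVec v) (fromVec w)
      near []       []       []       []       = tt
      near {t = t} (x ∷ xs) (y ∷ ys) (l ∷ ls) (u ∷ us) =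
        (subst (_< y ⊕ t) (⊖-cancelʳ x t) (⊕-monoˡ-< t l) , u) , near xs ys ls us

    -- Sparse sets and the chain property.

    -- Equivalently, X is closed and discrete.
    Sparse : (R → Set ℓ) → Set ℓ
    Sparse X = ∀ a → ∃[ t ] (𝟎 < t × (∀ x → X x → Near sc t a x → x ≡ a))

    sparse-⊆ : ∀ {X Y} → (∀ x → X x → Y x) → Sparse Y → Sparse X
    sparse-⊆ X⊆Y sp a = let t , 0<t , f = sp a in t , 0<t , λ x Xx → f x (X⊆Y x Xx)

    -- Condition (1) leaves discreteness, which gives the radius at points of `X`; closedness gives
    -- it at all other points.
    closed⇒sparse : ∀ {X} → Cl sc X → ¬ HasInt sc X → Sparse X
    closed⇒sparse {X} (mkCl D n) ¬int a
      with h X (Def⇒Definable D) (IsOp⇒IsOpen (λ x ¬Xx → let t , 0<t , f = n (proj₁ x) ¬Xx in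
             t , 0<t , λ y near → f (proj₁ y) (proj₁ near)))
    ... | inj₂ (p , q , (x , p<x , x<q) , I⊆X) = ⊥-elim (¬int (x , let t , 0<t , f = within p<x x<q in
            t , 0<t , λ y near → I⊆X (f y near)))
    ... | inj₁ discrete with em {X a}
    ...   | no ¬Xa = let t , 0<t , f = n a ¬Xa in t , 0<t , λ x Xx near → ⊥-elim (f x near Xx)
    ...   | yes Xa = let p , q , (p<a , a<q) , f = discrete a Xa
                         t , 0<t , g = within p<a a<q
                     in t , 0<t , λ x Xx near → f x Xx (g x near)

    -- Points of `X` approximate the infimum, and close to it the only possible point of `X` is the
    -- infimum itself.
    sparse-minimum : ∀ {X} → Def sc X → Sparse X → ∀ {x₀ b} → X x₀ → (∀ x → X x → b ≤ x) →
      ∃[ m ] (X m × (∀ x → X x → m ≤ x))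
    sparse-minimum {X} D sp Xx₀ b≤ =
      let m , m≤ , approx = infimum D Xx₀ b≤
          t , 0<t , isolated = sp m
          x , Xx , x<m⊕t = approx (m ⊕ t) (x<x⊕t 0<t)
      in m , subst X (isolated x Xx (≤-<-trans (m≤ x Xx) (x<x⊕t 0<t) , x<m⊕t)) Xx , m≤

    -- Interval induction makes the radius uniform. Only `u` is confined to the interval, so that
    -- the property glues across a common end.
    sparse-separation : ∀ {X} → Def sc X → Sparse X → ∀ lo hi →
      ∃[ w ] (𝟎 < w × (∀ u → X u → lo ≤ u → u ≤ hi → ∀ v → X v → Near sc w u v → u ≡ v))
    sparse-separation {X} D sp lo hi = [ cover , empty ]′ (≤-or-> lo hi)
      where
      Q : R → R → Set ℓ
      Q p q = ∃[ w ] (𝟎 < w × (∀ u → X u → p ≤ u → u ≤ q → ∀ v → X v → Near sc w u v → u ≡ v))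
      empty : hi < lo → Q lo hi
      empty hi<lo = let e , 0<e = positive in
        e , 0<e , λ u _ lo≤u u≤hi → ⊥-elim (≤-trans lo≤u u≤hi hi<lo)
      cover : lo ≤ hi → Q lo hi
      cover lo≤hi = interval-induction Q
        (∃d sc (constant 𝟎 <d #0 ∧d ∀d sc (app-d D #0 ⇒d #2 ≤d #0 ⇒d #0 ≤d ↓3 ⇒d
          ∀d sc (app-d D #0 ⇒d Def-near sc #2 #1 #0 ⇒d Cl.def (#1 ≡c #0)))))
        (λ u≤ ≤v (w , 0<w , f) → w , 0<w , λ u Xu p q → f u Xu (≤-trans u≤ p) (≤-trans q ≤v))
        (λ {_} {v} _ _ (w , 0<w , f) (w′ , 0<w′ , f′) → let z , 0<z , z≤w , z≤w′ = min₊ 0<w 0<w′ in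
          z , 0<z , λ u Xu p q y Xy near →
            [ (λ u≤v → f u Xu p u≤v y Xy (near-mono sc z≤w near))
            , (λ v<u → f′ u Xu (<-asym v<u) q y Xy (near-mono sc z≤w′ near)) ]′ (≤-or-> u v))
        lo≤hi
        λ c _ _ →
          let t , 0<t , isolated = sp c
              -- With half the isolating radius of `c`, both `u` and `v` fall within `t` of `c` and
              -- so both equal `c`.
              w , 0<w , w+w≤t = halve 0<t
              w≤t = ≤-trans (<-asym (x<x⊕t 0<w)) w+w≤t
              p , q , p<c , c<q , near-c = around c 0<w
          in p , q , p<c , c<q , w , 0<w , λ u Xu p≤u u≤q v Xv near → trans
               (isolated u Xu (near-mono sc w≤t (near-c u p≤u u≤q)))
               (sym (isolated v Xv (near-halves sc w+w≤t (near-c u p≤u u≤q) near)))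

    IsChain : (R × R → Set ℓ) → Set ℓ
    IsChain Y = ∀ i j → (∀ x → Y (i , x) → Y (j , x)) ⊎ (∀ x → Y (j , x) → Y (i , x))

    module _ (Y : R × R → Set ℓ) (D : Def (sc ⊗ sc) Y) (chain : IsChain Y)
             (sp : ∀ i → Sparse (λ x → Y (i , x))) (a : R) where

      -- `C` is the set of records. Entry into the chain is compared pairwise, with `i` depending on
      -- `y`, because a first index containing `x` may fail to exist.
      C A : R → Set ℓ
      C x = a < x × (∃[ i ] Y (i , x)) ×
        (∀ y → a < y → y < x → ∃[ i ] Y (i , y) → ∃[ i ] (Y (i , x) × ¬ Y (i , y)))
      A x = C x ⊎ x ≡ a

      A-d : Def sc A
      A-d = (constant a <d idT ∧d ∃d sc D ∧d
              ∀d sc (constant a <d #0 ⇒d #0 <d ↓1 ⇒d app-d (∃d sc D) #0 ⇒d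
                ∃d sc (app-d D (#0 ,T ↓2) ∧d ¬d (app-d D (#0 ,T #1)))))
            ∨d Cl.def (idT ≡c constant a)

      module _ (accumulates : ∀ t → 𝟎 < t → ∃[ i ] ∃[ x ] (Y (i , x) × a < x × x < a ⊕ t)) where

        -- Some `y` closer to `a` than `d` lies in a set `Y j`. A record farther out enters the
        -- chain before `y` does, hence already lies in `Y j`. So the records away from `a` inherit
        -- the sparseness of a single member of the chain.
        far-records : ∀ d → 𝟎 < d → ∃[ j ] (∀ x → a ⊕ d ≤ x → C x → Y (j , x))
        far-records d 0<d =
          let j , y , Yjy , a<y , y<a⊕d = accumulates d 0<d in
          j , λ x a⊕d≤x (_ , _ , earlier) →
            let i , Yix , ¬Yiy = earlier y a<y (<-≤-trans y<a⊕d a⊕d≤x) (j , Yjy) in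
            [ (λ i⊆j → i⊆j x Yix) , (λ j⊆i → ⊥-elim (¬Yiy (j⊆i y Yjy))) ]′ (chain i j)

        isolated-records : ∀ z → a < z →
          ∃[ t ] (𝟎 < t × (∀ x → Near sc t z x → a < x × (C x → x ≡ z)))
        isolated-records z a<z =
          let w , a<w , w<z = dense a<z
              d , 0<d , w≡a⊕d = difference a<w
              j , far = far-records d 0<d
              t , 0<t , isolated = sp j z
              _ , z<z⊕t = near-refl sc 0<t
              u , 0<u , f = within w<z z<z⊕t
              v , 0<v , v≤t , v≤u = min₊ 0<t 0<u
          in v , 0<v , λ x near →
            let w<x = proj₁ (f x (near-mono sc v≤u near)) in
            <-trans a<w w<x , λ Cx → isolated x
              (far x (subst (_≤ x) w≡a⊕d (<-asym w<x)) Cx) (near-mono sc v≤t near)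

        A-closed : Cl sc A
        A-closed = mkCl A-d closed
          where
          closed : IsCl A
          closed z ¬Az with IsDenseLinearOrder.compare isDenseLinearOrder a z
          ... | tri≈ _ refl _ = ⊥-elim (¬Az (inj₂ refl))
          ... | tri> _ _ z<a =
            let y , y<z = noMinimum z
                t , 0<t , f = within y<z z<a
            in t , 0<t , λ x near → λ where
                 (inj₁ (a<x , _)) → <-irrefl (<-trans a<x (proj₂ (f x near)))
                 (inj₂ refl) → <-irrefl (proj₂ (f x near))
          ... | tri< a<z _ _ =
            let t , 0<t , f = isolated-records z a<z in
            t , 0<t , λ x near → λ where
                 (inj₁ Cx) → ¬Az (inj₁ (subst C (proj₂ (f x near) Cx) Cx))
                 (inj₂ refl) → <-irrefl (proj₁ (f x near))

        A-no-interior : ¬ HasInt sc A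
        A-no-interior (c , t , 0<t , cube⊆A) =
          let u , 0<u , u<t = dense 0<t
              -- Right of the centre, `z` is certainly beyond `a`, where records are isolated; `y`
              -- is then one point of `A` too many.
              z = c ⊕ u
              a≤c = [ (λ (a<c , _) → <-asym a<c) , (λ c≡a → ≤-reflexive (sym c≡a)) ]′
                      (cube⊆A c (near-refl sc 0<t))
              a<z = ≤-<-trans a≤c (x<x⊕t 0<u)
              v , 0<v , isolated = isolated-records z a<z
              z<c⊕t = ⊕-monoʳ-< c u<t
              z<z⊕v = proj₁ (near-refl sc {x = z} 0<v)
              y , z<y , y<c⊕t , y<z⊕v = between z<c⊕t z<z⊕v
              y-near = <-trans z<y (x<x⊕t 0<v) , y<z⊕v
              c<y = <-trans (x<x⊕t 0<u) z<y
          in [ (λ Cy → <-irrefl (subst (z <_) (proj₂ (isolated y y-near) Cy) z<y))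
             , (λ y≡a → <-irrefl (subst (_< y) (sym y≡a) (≤-<-trans a≤c c<y))) ]′
             (cube⊆A y (<-trans c<y (x<x⊕t 0<t) , y<c⊕t))
          where
          between : ∀ {z p q} → z < p → z < q → ∃[ y ] (z < y × y < p × y < q)
          between {p = p} {q} z<p z<q with ≤-or-> p q
          ... | inj₁ p≤q = let y , z<y , y<p = dense z<p in y , z<y , y<p , <-≤-trans y<p p≤q
          ... | inj₂ q<p = let y , z<y , y<q = dense z<q in y , z<y , <-trans y<q q<p , y<q

        -- The leftmost point of `Y j` beyond `a` is a record: the one index `j` separates it from
        -- every point nearer to `a`.
        records-accumulate : ∀ t → 𝟎 < t → ∃[ m ] (C m × m < a ⊕ t)
        records-accumulate t 0<t = leftmost (accumulates t 0<t)
          where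
          record-of : ∀ j y → y < a ⊕ t → Y (j , y) × a < y →
            ∃[ m ] ((Y (j , m) × a < m) × (∀ x → Y (j , x) × a < x → m ≤ x)) → ∃[ m ] (C m × m < a ⊕ t)
          record-of j y y<a⊕t Yy (m , (Yjm , a<m) , m≤) =
            m , (a<m , (j , Yjm) , λ x a<x x<m _ → j , Yjm , λ Yjx → m≤ x (Yjx , a<x) x<m)
              , ≤-<-trans (m≤ y Yy) y<a⊕t
          leftmost : ∃[ j ] ∃[ y ] (Y (j , y) × a < y × y < a ⊕ t) → ∃[ m ] (C m × m < a ⊕ t)
          leftmost (j , y , Yjy , a<y , y<a⊕t) = record-of j y y<a⊕t (Yjy , a<y)
            (sparse-minimum (app-d D (constant j ,T idT) ∧d constant a <d idT)
              (sparse-⊆ (λ x → proj₁) (sp j)) (Yjy , a<y) (λ x (_ , a<x) → <-asym a<x))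

        contradiction : ⊥
        contradiction = no-gap (closed⇒sparse A-closed A-no-interior a)
          where
          no-gap : ∃[ t ] (𝟎 < t × (∀ x → A x → Near sc t a x → x ≡ a)) → ⊥
          no-gap (t , 0<t , isolated) =
            let m , Cm , m<a⊕t = records-accumulate t 0<t
                a<m = proj₁ Cm
            in <-irrefl (subst (a <_) (isolated m (inj₁ Cm) (<-trans a<m (x<x⊕t 0<t) , m<a⊕t)) a<m)

    -- If the union of a chain of sparse sets accumulated at a from the right, then the points of the
    -- union that enter the chain earlier than all points between them and a would form,
    -- together with a, a closed set that is neither discrete nor has interior.
    chain-sparse-right : ∀ Y → Def (sc ⊗ sc) Y → IsChain Y → (∀ i → Sparse (λ x → Y (i , x))) → ∀ a →
      ∃[ t ] (𝟎 < t × (∀ i x → Y (i , x) → a < x → a ⊕ t ≤ x))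
    chain-sparse-right Y D chain sp a = by-contradiction λ none →
      contradiction Y D chain sp a λ t 0<t → by-contradiction λ ¬∃ →
        none (t , 0<t , λ i x Yix a<x x<a⊕t → ¬∃ (i , x , Yix , a<x , x<a⊕t))

    -- The left side is the right side of the family reflected by `⊖_`.
    chain-sparse : ∀ Y → Def (sc ⊗ sc) Y → IsChain Y → (∀ i → Sparse (λ x → Y (i , x))) →
      Sparse (λ x → ∃[ i ] Y (i , x))
    chain-sparse Y D chain sp a =
      let t , 0<t , right = chain-sparse-right Y D chain sp a
          u , 0<u , left = chain-sparse-right (λ (i , x) → Y (i , ⊖ x)) (app-d D (#0 ,T -T ↓1))
            (λ i j → [ (λ f → inj₁ λ x → f (⊖ x)) , (λ f → inj₂ λ x → f (⊖ x)) ]′ (chain i j))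
            (λ i b → let v , 0<v , f = sp i (⊖ b) in v , 0<v , λ x Yix (p , q) →
              trans (sym (⊖-involutive x)) (trans (cong ⊖_ (f (⊖ x) Yix (⊖-anti-⊕ q , ⊖-anti-⊕ p))) (⊖-involutive b)))
            (⊖ a)
          w , 0<w , w≤t , w≤u = min₊ 0<t 0<u
      in w , 0<w , λ x (i , Yix) (a<x⊕w , x<a⊕w) → ≤-antisym
           (λ a<x → right i x Yix a<x (<-≤-trans x<a⊕w (⊕-monoʳ-≤ a w≤t)))
           (λ x<a → left i (⊖ x) (subst (λ z → Y (i , z)) (sym (⊖-involutive x)) Yix) (⊖-anti-< x<a)
             (⊖-anti-⊕ (<-≤-trans a<x⊕w (⊕-monoʳ-≤ x w≤u))))

    -- Monotone families of closed sets and shrinking cubes.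

    Monotone : ∀ {a} → (El (sc ⊗ sc ⊗ a) → Set ℓ) → Set ℓ
    Monotone F = ∀ {r r′ s s′ x} → r ≤ r′ → s′ ≤ s → F (r , s , x) → F (r′ , s′ , x)

    -- The chain property is applied twice: in `r` for fixed `s`, then in `s` to the resulting
    -- unions. An `s` that is not positive gets the empty set, so that the family is indexed by all
    -- of `R`.
    union-sparse : ∀ {F} → Cl (sc ⊗ sc ⊗ sc) F → Monotone F →
      (∀ r s → 𝟎 < s → ¬ HasInt sc (λ x → F (r , s , x))) →
      Sparse (λ x → ∃[ r ] ∃[ s ] (𝟎 < s × F (r , s , x)))
    union-sparse {F} C mono ¬int = sparse-⊆ (λ x (r , s , 0<s , p) → s , 0<s , r , p)
      (chain-sparse (λ (s , x) → 𝟎 < s × ∃[ r ] F (r , s , x))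
        (constant 𝟎 <d #0 ∧d ∃d sc (Cl.def C)) chain₂ sparse₂)
      where
      chain₂ : IsChain (λ (s , x) → 𝟎 < s × ∃[ r ] F (r , s , x))
      chain₂ s s′ with em {𝟎 < s} | em {𝟎 < s′}
      ... | no s≤0  | _      = inj₁ λ x (0<s , _) → ⊥-elim (s≤0 0<s)
      ... | yes _   | no s′≤0 = inj₂ λ x (0<s′ , _) → ⊥-elim (s′≤0 0<s′)
      ... | yes 0<s | yes 0<s′ with ≤-or-> s s′
      ...   | inj₁ s≤s′ = inj₂ λ x (_ , r , p) → 0<s , r , mono ≤-refl s≤s′ p
      ...   | inj₂ s′<s = inj₁ λ x (_ , r , p) → 0<s′ , r , mono ≤-refl (<-asym s′<s) p
      sparse₂ : ∀ s → Sparse (λ x → 𝟎 < s × ∃[ r ] F (r , s , x))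
      sparse₂ s with em {𝟎 < s}
      ... | no s≤0 = λ a → let e , 0<e = positive in e , 0<e , λ x (0<s , _) → ⊥-elim (s≤0 0<s)
      ... | yes 0<s = sparse-⊆ (λ x → proj₂) (chain-sparse (λ (r , x) → F (r , s , x))
        (app-d (Cl.def C) (#0 ,T constant s ,T ↓1))
        (λ r r′ → [ (λ r≤r′ → inj₁ λ x → mono r≤r′ ≤-refl) , (λ r′<r → inj₂ λ x → mono (<-asym r′<r) ≤-refl) ]′
                    (≤-or-> r r′))
        (λ r → closed⇒sparse (app-c C (constant r ,T constant s ,T idT)) (¬int r s 0<s)))

    -- Containment in the old cube is part of the conclusion, so that successive shrinkings compose.
    Within : ∀ a → El a → R → (El a → Set ℓ) → Set ℓ
    Within a c t Φ = ∃[ c′ ] ∃[ t′ ] (𝟎 < t′ × (∀ x → Near a t′ c′ x → Near a t c x × Φ x))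

    within-map : ∀ {a c t} {Φ Ψ : El a → Set ℓ} → (∀ x → Near a t c x → Φ x → Ψ x) →
      Within a c t Φ → Within a c t Ψ
    within-map f (c′ , t′ , 0<t′ , g) = c′ , t′ , 0<t′ , λ x near → let near′ , Φx = g x near in near′ , f x near′ Φx

    everywhere : ∀ {a c t} {Φ : El a → Set ℓ} → 𝟎 < t → (∀ x → Near a t c x → Φ x) → Within a c t Φ
    everywhere {c = c} {t} 0<t f = c , t , 0<t , λ x near → near , f x near

    nearby : ∀ {a x c t} {Φ : El a → Set ℓ} → Near a t c x → Int Φ x → Within a c t Φ
    nearby {a} {x} {c} {t} near (u , 0<u , f) =
      let v , 0<v , g = near-c a c t x near
          w , 0<w , w≤u , w≤v = min₊ 0<u 0<v
      in x , w , 0<w , λ y near′ → g y (near-mono a w≤v near′) , f y (near-mono a w≤u near′)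

    -- The height at which the lowest point of the fibre over x lies is lower semicontinuous in x, hence
    -- almost constant near a point where it almost attains its supremum.
    bounded-section : ∀ {a} {K : El (sc ⊗ a) → Set ℓ} → Cl (sc ⊗ a) K → ∀ lo hi {ε c t} → 𝟎 < ε → 𝟎 < t →
      (∀ x → Near a t c x → ∃[ y ] ((lo ≤ y × y ≤ hi) × K (y , x))) →
      ∃[ y₀ ] Within a c t (λ x → ∃[ y ] ((y₀ ≤ y × y ≤ y₀ ⊕ ε) × K (y , x)))
    bounded-section {a} {K} C lo hi {ε} {c} {t} 0<ε 0<t fibre = cases em
      where
      Above : R → El a → Set ℓ
      Above v x = ¬ (∃[ y ] ((lo ≤ y × y ≤ v) × K (y , x)))
      V : R → Set ℓ
      V v = lo ≤ v × ∃[ x ] (Near a t c x × Above v x)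
      V-d : Def sc V
      V-d = constant lo ≤d idT ∧d ∃d a (Def-near a (constant t) (constant c) #0 ∧d
        ¬d (∃d sc ((constant lo ≤d #0 ∧d #0 ≤d ↓2) ∧d app-d (Cl.def C) (#0 ,T #1))))
      V≤hi : ∀ v → V v → v ≤ hi
      V≤hi v (_ , x , near , above) hi<v =
        let y , (lo≤y , y≤hi) , k = fibre x near in above (y , (lo≤y , ≤-trans y≤hi (<-asym hi<v)) , k)
      ¬V⇒ : ∀ v → lo ≤ v → ¬ V v → ∀ x → Near a t c x → ∃[ y ] ((lo ≤ y × y ≤ v) × K (y , x))
      ¬V⇒ v lo≤v ¬Vv x near = by-contradiction λ above → ¬Vv (lo≤v , x , near , above)
      Goal = ∃[ y₀ ] Within a c t (λ x → ∃[ y ] ((y₀ ≤ y × y ≤ y₀ ⊕ ε) × K (y , x)))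
      near-top : ∃[ m ] ((∀ v → V v → v ≤ m) × (∀ u → u < m → ∃[ v ] (V v × u < v))) → Goal
      near-top (m , ≤m , approx) = choose (halve 0<ε)
        where
        choose : ∃[ η ] (𝟎 < η × η ⊕ η ≤ ε) → Goal
        choose (η , 0<η , η+η≤ε) = witness (approx (m ⊕ ⊖ η) (x⊖t<x 0<η))
          where
          -- Near `x` the fibres miss the range from `lo` to `v`, yet all fibres meet the range from
          -- `lo` to `m ⊕ η`, and `m ⊕ η` is at most `v ⊕ ε`. So `v` serves as `y₀`.
          witness : ∃[ v ] (V v × m ⊕ ⊖ η < v) → Goal
          witness (v , (lo≤v , x , near , above) , m-η<v) =
            v , within-map low (nearby near (Cl.nbhd (∃≤c C (constant lo) (constant v)) x above))
            where
            m<v+η : m < v ⊕ η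
            m<v+η = subst (_< v ⊕ η) (⊖-cancelʳ m η) (⊕-monoˡ-< η m-η<v)
            v≤m : v ≤ m
            v≤m = ≤m v (lo≤v , x , near , above)
            low : ∀ x → Near a t c x → Above v x → ∃[ y ] ((v ≤ y × y ≤ v ⊕ ε) × K (y , x))
            low x near above =
              let y , (lo≤y , y≤m+η) , k = ¬V⇒ (m ⊕ η) (≤-trans lo≤v (≤-trans v≤m (<-asym (x<x⊕t 0<η))))
                    (λ Vm+η → ≤m (m ⊕ η) Vm+η (x<x⊕t 0<η)) x near
              in y , ((λ y<v → above (y , (lo≤y , <-asym y<v) , k))
                     , ≤-trans y≤m+η (≤-trans (⊕-monoˡ-≤ η (<-asym m<v+η))
                         (≤-trans (≤-reflexive (assoc v η η)) (⊕-monoʳ-≤ v η+η≤ε)))) , k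
      cases : Dec (∃[ v ] V v) → Goal
      cases (yes (v , Vv)) = near-top (supremum V-d Vv V≤hi)
      -- If `V` is empty, then `lo` itself lies in every fibre.
      cases (no ¬V) = lo , everywhere 0<t λ x near →
        let y , (lo≤y , y≤lo) , k = ¬V⇒ lo ≤-refl (λ Vlo → ¬V (lo , Vlo)) x near
        in y , (lo≤y , ≤-trans y≤lo (<-asym (x<x⊕t 0<ε))) , k

    -- Σ-sets and their closure properties.

    record Σset (a : Ty) (P : El a → Set ℓ) : Set (s ⊔ lsuc ℓ) where
      field
        F      : El (sc ⊗ sc ⊗ a) → Set ℓ
        closed : Cl (sc ⊗ sc ⊗ a) F
        mono   : Monotone F
        cover  : ∀ x → P x → ∃[ r ] ∃[ s ] (𝟎 < s × F (r , s , x))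
        sound  : ∀ {r s x} → 𝟎 < s → F (r , s , x) → P x

    Union∃ : ∀ {a} → (El (sc ⊗ sc ⊗ a) → Set ℓ) → El a → Set ℓ
    Union∃ F x = ∃[ r ] ∃[ s ] (𝟎 < s × F (r , s , x))

    Σ-union : ∀ {a F} → Cl (sc ⊗ sc ⊗ a) F → Monotone F → Σset a (Union∃ F)
    Σ-union {F = F} C mono = record
      { F = F ; closed = C ; mono = mono ; cover = λ x p → p ; sound = λ 0<s p → _ , _ , 0<s , p }

    Σ-def : ∀ {a P} → Σset a P → Def a P
    Σ-def S = resp-d (∃d sc (∃d sc (constant 𝟎 <d #0 ∧d app-d (Cl.def closed) (#1 ,T #0 ,T ↓2))))
      λ x → mk⇔ (λ (r , s , 0<s , p) → sound 0<s p) (cover x)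
      where open Σset S

    -- The closed sets collect the centres of cubes of radius `s` inside `P`. For fixed `y` the
    -- condition is an implication from an open condition on `s` and `x` to a constant, hence
    -- closed.
    Σ-open : ∀ {a P} → Op a P → Σset a P
    Σ-open {a} {P} (mkOp D n) = record
      { F = λ (r , s , x) → ∀ y → Near a s x y → P y
      ; closed = ∀sections-c a (Def-near a #2 ↓3 #0 ⇒d app-d D #0) sections
      ; mono = λ _ s′≤s f y near → f y (near-mono a s′≤s near)
      ; cover = λ x Px → let t , 0<t , f = n x Px in 𝟎 , t , 0<t , f
      ; sound = λ 0<s f → f _ (near-refl a 0<s)
      }
      where
      sections : ∀ y → IsCl {sc ⊗ sc ⊗ a} (λ (r , s , x) → Near a s x y → P y)
      sections y z ¬f =
        let near = by-contradiction (λ ¬near → ¬f (λ near → ⊥-elim (¬near near)))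
            t , 0<t , g = Op.nbhd (near-o a #1 ↓2 (constant y)) z near
        in t , 0<t , λ z′ near′ f → ¬f (λ _ → f (g z′ near′))

    Σ-closed : ∀ {a P} → Cl a P → Σset a P
    Σ-closed {P = P} C = record
      { F = λ (_ , _ , x) → P x ; closed = app-c C ↓2 ; mono = λ _ _ p → p
      ; cover = λ x p → let e , 0<e = positive in 𝟎 , e , 0<e , p ; sound = λ _ p → p }

    Σ-app : ∀ {a b P} → Σset b P → (f : Tm a b) → Σset a (λ x → P (map f x))
    Σ-app S f = record { F = λ (r , s , x) → F (r , s , map f x) ; closed = app-c closed (#0 ,T #1 ,T f ∘T ↓2)
      ; mono = mono ; cover = λ x → cover (map f x) ; sound = sound }
      where open Σset S

    infixr 6 _∧Σ_
    _∧Σ_ : ∀ {a P Q} → Σset a P → Σset a Q → Σset a (λ x → P x × Q x)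
    S ∧Σ T = record
      { F = λ x → S.F x × T.F x
      ; closed = S.closed ∧c T.closed
      ; mono = λ r≤ ≤s (p , q) → S.mono r≤ ≤s p , T.mono r≤ ≤s q
      ; cover = λ x (p , q) →
          let r , s , 0<s , p′ = S.cover x p
              r′ , s′ , 0<s′ , q′ = T.cover x q
              r″ , r≤ , r′≤ = upper r r′
              s″ , 0<s″ , ≤s , ≤s′ = min₊ 0<s 0<s′
          in r″ , s″ , 0<s″ , S.mono r≤ ≤s p′ , T.mono r′≤ ≤s′ q′
      ; sound = λ 0<s (p , q) → S.sound 0<s p , T.sound 0<s q
      }
      where
      module S = Σset S
      module T = Σset T

    -- The index `r` exists for this step: a search among `y` bounded by `r` keeps the projection
    -- closed, and every `y` is bounded by some `r`.
    Σ-∃ : ∀ b {a P} → Σset (b ⊗ a) P → Σset a (λ x → ∃[ y ] P (y , x))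
    Σ-∃ b S = record
      { F = λ (r , s , x) → ∃[ y ] (Bdd b r y × F (r , s , y , x))
      ; closed = ∃Bddc b (app-c closed (#1 ,T #2 ,T #0 ,T ↓3)) #0
      ; mono = λ r≤ ≤s (y , y≤ , p) → y , Bdd-mono b r≤ y≤ , mono r≤ ≤s p
      ; cover = λ x (y , p) →
          let r , s , 0<s , p′ = cover (y , x) p
              r′ , y≤r′ = bounded b y
              r″ , r≤ , r′≤ = upper r r′
          in r″ , s , 0<s , y , Bdd-mono b r′≤ y≤r′ , mono r≤ ≤-refl p′
      ; sound = λ 0<s (y , _ , p) → y , sound 0<s p
      }
      where open Σset S

    -- Baire property and nowhere density, by induction on the number of variables.

    Baire NowhereDense : Ty → Set (s ⊔ lsuc ℓ)
    Baire a = ∀ {F} → Cl (sc ⊗ sc ⊗ a) F → Monotone F → HasInt a (Union∃ F) →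
      ∃[ r ] ∃[ s ] (𝟎 < s × HasInt a (λ x → F (r , s , x)))
    NowhereDense a = ∀ {P} → Σset a P → ¬ HasInt a P → ∀ c t → 𝟎 < t → Within a c t (λ x → ¬ P x)

    -- The given cube is open and so a Σ-set; intersecting the family with it keeps the resulting
    -- cube inside.
    baire-within : ∀ {a} → Baire a → ∀ {F} → Cl (sc ⊗ sc ⊗ a) F → Monotone F → ∀ {c t} → 𝟎 < t →
      (∀ x → Near a t c x → Union∃ F x) →
      ∃[ r ] ∃[ s ] (𝟎 < s × Within a c t (λ x → F (r , s , x)))
    baire-within {a} baire {F} C mono {c} {t} 0<t ⊆∪ = conclude
      (baire closed monoFN (c , t , 0<t , λ x near → cover x (⊆∪ x near , near)))
      where
      open Σset (Σ-union C mono ∧Σ Σ-open (near-o a (constant t) (constant c) idT)) renaming (F to FN; mono to monoFN)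
      conclude : ∃[ r ] ∃[ s ] (𝟎 < s × HasInt a (λ x → FN (r , s , x))) →
        ∃[ r ] ∃[ s ] (𝟎 < s × Within a c t (λ x → F (r , s , x)))
      conclude (r , s , 0<s , c′ , t′ , 0<t′ , f) =
        r , s , 0<s , c′ , t′ , 0<t′ , λ x near → proj₂ (sound 0<s (f x near)) , proj₁ (f x near)

    sparse⇒no-interior : ∀ {X} → Sparse X → ¬ HasInt sc X
    sparse⇒no-interior sp (c , t , 0<t , cube⊆X) =
      let u , 0<u , isolated = sp c
          w , 0<w , w≤t , w≤u = min₊ 0<t 0<u
          v , 0<v , v<w = dense 0<w
          near : Near sc w c (c ⊕ v)
          near = <-trans (x<x⊕t 0<v) (x<x⊕t 0<w) , ⊕-monoʳ-< c v<w
          c+v≡c = isolated (c ⊕ v) (cube⊆X (c ⊕ v) (near-mono sc w≤t near)) (near-mono sc w≤u near)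
      in <-irrefl (subst (c <_) c+v≡c (x<x⊕t 0<v))

    module Fibres {a : Ty} {F : El (sc ⊗ sc ⊗ sc ⊗ a) → Set ℓ}
                  (C : Cl (sc ⊗ sc ⊗ sc ⊗ a) F) (mono : Monotone F) where

      Bar : El (sc ⊗ sc ⊗ sc ⊗ a) → Set ℓ
      Bar (y , r , s , x) = ∀ z → y < z → z < y ⊕ s → F (r , s , z , x)

      Bar-c : Cl (sc ⊗ sc ⊗ sc ⊗ a) Bar
      Bar-c = ∀c sc (#1 <o #0 ⇒c #0 <o #1 +T #3 ⇒c app-c C (#2 ,T #3 ,T #0 ,T ↓4))

      -- The base points whose fibre contains an interval. Bounding the left end by `r` makes `H`
      -- closed, and letting `s` double as the length of the interval keeps it a monotone family in
      -- the same two indices.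
      H : El (sc ⊗ sc ⊗ a) → Set ℓ
      H (r , s , x) = ∃[ y ] ((⊖ r ≤ y × y ≤ r) × Bar (y , r , s , x))

      H-c : Cl (sc ⊗ sc ⊗ a) H
      H-c = ∃≤c Bar-c (-T #0) #0

      H-mono : Monotone H
      H-mono r≤ ≤s (y , y≤ , bar) = y , Bdd-mono sc r≤ y≤ , λ z y<z z<y+s →
        mono r≤ ≤s (bar z y<z (<-≤-trans z<y+s (⊕-monoʳ-≤ y ≤s)))

      H-cover : ∀ {r s x} → 𝟎 < s → HasInt sc (λ y → F (r , s , y , x)) → Union∃ H x
      H-cover {r} {s} 0<s (c , t , 0<t , f) =
        let r′ , c≤r′ = bounded sc c
            r″ , r≤ , r′≤ = upper r r′
            s″ , 0<s″ , ≤s , ≤t = min₊ 0<s 0<t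
        in r″ , s″ , 0<s″ , c , Bdd-mono sc r′≤ c≤r′ , λ z c<z z<c+s″ → mono r≤ ≤s
             (f z (<-trans c<z (x<x⊕t 0<t) , <-≤-trans z<c+s″ (⊕-monoʳ-≤ c ≤t)))

      sparse-fibre : ∀ {x} → ¬ Union∃ H x → Sparse (λ y → Union∃ F (y , x))
      sparse-fibre {x} ¬Hx = union-sparse {λ (r , s , y) → F (r , s , y , x)}
        (app-c C (#0 ,T #1 ,T ↓2 ,T constant x)) mono λ r s 0<s int → ¬Hx (H-cover 0<s int)

      -- Baire for `a` fixes `r` and `s`, so that all fibres over a cube contain intervals of length
      -- `s`. On a smaller cube `bounded-section` confines their left ends between `y₀` and `y₀ ⊕ ε`
      -- with `ε < s`; they all contain the interval from `y₀ ⊕ ε` to `y₀ ⊕ s`.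
      interior : Baire a → HasInt a (Union∃ H) → ∃[ r ] ∃[ s ] (𝟎 < s × HasInt (sc ⊗ a) (λ x → F (r , s , x)))
      interior baire int = thicken (baire H-c H-mono int)
        where
        Goal = ∃[ r ] ∃[ s ] (𝟎 < s × HasInt (sc ⊗ a) (λ x → F (r , s , x)))
        thicken : ∃[ r ] ∃[ s ] (𝟎 < s × HasInt a (λ x → H (r , s , x))) → Goal
        thicken (r , s , 0<s , c , t , 0<t , f) = shrink (dense 0<s)
          where
          shrink : ∃[ ε ] (𝟎 < ε × ε < s) → Goal
          shrink (ε , 0<ε , ε<s) = box
            (bounded-section (app-c Bar-c (#0 ,T constant r ,T constant s ,T ↓1)) (⊖ r) r 0<ε 0<t f)
            where
            box : ∃[ y₀ ] Within a c t (λ x → ∃[ y ] ((y₀ ≤ y × y ≤ y₀ ⊕ ε) × Bar (y , r , s , x))) → Goal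
            box (y₀ , c′ , t′ , 0<t′ , g) =
              let m , y₀+ε<m , m<y₀+s = dense (⊕-monoʳ-< y₀ ε<s)
                  u , 0<u , near⇒ = within y₀+ε<m m<y₀+s
                  w , 0<w , w≤t′ , w≤u = min₊ 0<t′ 0<u
              in r , s , 0<s , (m , c′) , w , 0<w , λ (z , x) (near-z , near-x) →
                   let _ , y , (y₀≤y , y≤y₀+ε) , bar = g x (near-mono a w≤t′ near-x)
                       y₀+ε<z , z<y₀+s = near⇒ z (near-mono sc w≤u near-z)
                   in bar z (≤-<-trans y≤y₀+ε y₀+ε<z) (<-≤-trans z<y₀+s (⊕-monoˡ-≤ s y₀≤y))

    baire-one : Baire one
    baire-one C mono (_ , t , 0<t , f) =
      let r , s , 0<s , p = f tt tt in r , s , 0<s , tt , t , 0<t , λ _ _ → p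

    -- The fibre over each point of the base cube contains an interval, so it is not sparse, and
    -- therefore the base point lies in the union of `H`.
    baire-⊗ : ∀ {a} → Baire a → Baire (sc ⊗ a)
    baire-⊗ {a} baire {F} C mono ((y , x) , t , 0<t , f) = interior baire (x , t , 0<t , in-H)
      where
      open Fibres C mono
      in-H : ∀ x′ → Near a t x x′ → Union∃ H x′
      in-H x′ near = by-contradiction λ ¬H → sparse⇒no-interior (sparse-fibre ¬H)
        (y , t , 0<t , λ y′ near′ → f (y′ , x′) (near′ , near))

    -- Apply Baire to the closed sets obtained by deleting the interiors of the P w.
    eventually-avoids : ∀ {a} → Baire a → NowhereDense a → ∀ {P : El (sc ⊗ a) → Set ℓ} → Def (sc ⊗ a) P →
      (∀ w → 𝟎 < w → Σset a (λ x → P (w , x))) →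
      ∀ {c t} → 𝟎 < t → (∀ x → Near a t c x → ∃[ w ] (𝟎 < w × (∀ w′ → 𝟎 < w′ → w′ ≤ w → ¬ P (w′ , x)))) →
      ∃[ w ] (𝟎 < w × Within a c t (λ x → ¬ P (w , x)))
    eventually-avoids {a} baire nd {P} D S {c} {t} 0<t avoids = conclude
      (baire-within baire {F} F-c (λ r≤ ≤s f w 0<w w<s → f w 0<w (<-≤-trans w<s ≤s)) 0<t λ x near →
        let w , 0<w , ¬P = avoids x near in 𝟎 , w , 0<w , λ w′ 0<w′ w′<w (u , 0<u , f) →
          ¬P w′ 0<w′ (<-asym w′<w) (f x (near-refl a 0<u)))
      where
      F : El (sc ⊗ sc ⊗ a) → Set ℓ
      -- The strict bound keeps `F` closed in `w`, at the price of passing to some `w′ < w` at the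
      -- end.
      F (_ , w , x) = ∀ w′ → 𝟎 < w′ → w′ < w → ¬ Int (λ y → P (w′ , y)) x
      F-c : Cl (sc ⊗ sc ⊗ a) F
      F-c = ∀sections-c sc
        (constant 𝟎 <d #0 ⇒d #0 <d #2 ⇒d ¬d (app-d (Int-d a D) (#0 ,T ↓3)))
        λ w′ → Cl.nbhd (constant 𝟎 <o constant w′ ⇒c constant w′ <o #1 ⇒c
                         ¬c (app-o (Int-o (app-d D (constant w′ ,T idT))) ↓2))
      Goal = ∃[ w ] (𝟎 < w × Within a c t (λ x → ¬ P (w , x)))
      conclude : ∃[ r ] ∃[ s ] (𝟎 < s × Within a c t (λ x → F (r , s , x))) → Goal
      conclude (_ , w , 0<w , c′ , t′ , 0<t′ , f) = smaller (dense 0<w)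
        where
        smaller : ∃[ w′ ] (𝟎 < w′ × w′ < w) → Goal
        smaller (w′ , 0<w′ , w′<w) = w′ , 0<w′ , restrict
          (nd (S w′ 0<w′ ∧Σ Σ-open (near-o a (constant t′) (constant c′) idT))
            (λ (x , u , 0<u , g) → let _ , near = g x (near-refl a 0<u) in
              proj₂ (f x near) w′ 0<w′ w′<w (u , 0<u , λ y near′ → proj₁ (g y near′)))
            c′ t′ 0<t′)
          where
          restrict : Within a c′ t′ (λ x → ¬ (P (w′ , x) × Near a t′ c′ x)) → Within a c t (λ x → ¬ P (w′ , x))
          restrict (c″ , t″ , 0<t″ , g) = c″ , t″ , 0<t″ , λ x near →
            let near′ , ¬P = g x near in proj₁ (f x near′) , λ p → ¬P (p , near′)

    -- If the union of `H` had interior, so would `P`. Hence some smaller cube misses that union,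
    -- and the fibres over it are sparse.
    sparse-fibres : ∀ {a} → Baire a → NowhereDense a → ∀ {P} → Σset (sc ⊗ a) P → ¬ HasInt (sc ⊗ a) P →
      ∀ c t → 𝟎 < t → Within a c t (λ x → Sparse (λ y → P (y , x)))
    sparse-fibres {a} baire nd {P} S ¬int c t 0<t =
      within-map (λ x _ ¬Hx → sparse-⊆ (λ y → cover (y , x)) (sparse-fibre ¬Hx))
        (nd (Σ-union H-c H-mono) (λ int → no-box (interior baire int)) c t 0<t)
      where
      open Σset S
      open Fibres closed mono
      no-box : ¬ (∃[ r ] ∃[ s ] (𝟎 < s × HasInt (sc ⊗ a) (λ x → F (r , s , x))))
      no-box (r , s , 0<s , c , t , 0<t , f) = ¬int (c , t , 0<t , λ x near → sound 0<s (f x near))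

    nowhereDense-one : NowhereDense one
    nowhereDense-one S ¬int c t 0<t = everywhere 0<t λ _ _ p → ¬int (tt , t , 0<t , λ _ _ → p)

    -- Over a smaller base cube each fibre misses a short interval just right of `y₀`; since `y₀`
    -- itself may belong to the fibre, `Strip` is one-sided. `eventually-avoids` gives these
    -- intervals a common length, which yields a box off `P`.
    nowhereDense-⊗ : ∀ {a} → Baire a → NowhereDense a → NowhereDense (sc ⊗ a)
    nowhereDense-⊗ {a} baire nd {P} S ¬int (y₀ , x₀) t 0<t = strip (sparse-fibres baire nd S ¬int x₀ t 0<t)
      where
      Goal = Within (sc ⊗ a) (y₀ , x₀) t (λ x → ¬ P x)
      Strip : El (sc ⊗ a) → Set ℓ
      Strip (w , x) = ∃[ y ] ((y₀ < y × y < y₀ ⊕ w) × P (y , x))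
      strip : Within a x₀ t (λ x → Sparse (λ y → P (y , x))) → Goal
      strip (c , t′ , 0<t′ , sparse) = conclude (eventually-avoids baire nd {Strip}
        (∃d sc ((constant y₀ <d #0 ∧d #0 <d constant y₀ +T #1) ∧d app-d (Σ-def S) (#0 ,T ↓2)))
        (λ w _ → Σ-∃ sc (Σ-open (constant y₀ <o #0 ∧o #0 <o constant y₀ +T constant w) ∧Σ S))
        0<t′ λ x near → let w , 0<w , isolated = proj₂ (sparse x near) y₀ in
          w , 0<w , λ w′ 0<w′ w′≤w (y , (y₀<y , y<y₀+w′) , p) →
            <-irrefl (subst (y₀ <_) (isolated y p (<-trans y₀<y (x<x⊕t 0<w) ,
              <-≤-trans y<y₀+w′ (⊕-monoʳ-≤ y₀ w′≤w))) y₀<y))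
        where
        conclude : ∃[ w ] (𝟎 < w × Within a c t′ (λ x → ¬ Strip (w , x))) → Goal
        conclude (w , 0<w , c′ , u , 0<u , f) =
          let v , 0<v , v≤w , v≤t = min₊ 0<w 0<t
              m , y₀<m , m<y₀+v = dense (x<x⊕t {y₀} 0<v)
              u′ , 0<u′ , near⇒ = within y₀<m m<y₀+v
              z , 0<z , z≤u , z≤u′ = min₊ 0<u 0<u′
          in (m , c′) , z , 0<z , λ (y , x) (near-y , near-x) →
               let near-c , ¬strip = f x (near-mono a z≤u near-x)
                   y₀<y , y<y₀+v = near⇒ y (near-mono sc z≤u′ near-y)
               in ((<-trans y₀<y (x<x⊕t 0<t) , <-≤-trans y<y₀+v (⊕-monoʳ-≤ y₀ v≤t)) , proj₁ (sparse x near-c))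
                  , λ p → ¬strip (y , (y₀<y , <-≤-trans y<y₀+v (⊕-monoʳ-≤ y₀ v≤w)) , p)

    baire : ∀ n → Baire (pow n)
    baire zero    = baire-one
    baire (suc n) = baire-⊗ (baire n)

    nowhereDense : ∀ n → NowhereDense (pow n)
    nowhereDense zero    = nowhereDense-one
    nowhereDense (suc n) = nowhereDense-⊗ (baire n) (nowhereDense n)

    -- Coordinate projections, dimension and uniform separation.

    coord : ∀ {n} → Fin n → Tm (pow n) sc
    coord zero    = #0
    coord (suc i) = coord i ∘T ↓1

    coords : ∀ {n d} → Vec (Fin n) d → Tm (pow n) (pow d)
    coords []      = !T
    coords (i ∷ f) = coord i ,T coords f

    near-coord : ∀ {n} (i : Fin n) {t x y} → Near (pow n) t x y → Near sc t (map (coord i) x) (map (coord i) y)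
    near-coord zero    (near , _) = near
    near-coord (suc i) (_ , near) = near-coord i near

    Bdd-coord : ∀ {n} (i : Fin n) {r x} → Bdd (pow n) r x → Bdd sc r (map (coord i) x)
    Bdd-coord zero    (b , _) = b
    Bdd-coord (suc i) (_ , b) = Bdd-coord i b

    coord-ext : ∀ n {x y} → (∀ (i : Fin n) → map (coord i) x ≡ map (coord i) y) → x ≡ y
    coord-ext zero    eq = refl
    coord-ext (suc n) eq = cong₂ _,_ (eq zero) (coord-ext n (λ i → eq (suc i)))

    coord-coords : ∀ {n d} (f : Vec (Fin n) d) i x → map (coord i) (map (coords f) x) ≡ map (coord (lookup f i)) x
    coord-coords (j ∷ f) zero    x = refl
    coord-coords (j ∷ f) (suc i) x = coord-coords f i x

    Image : ∀ {n d} → Vec (Fin n) d → (El (pow n) → Set ℓ) → El (pow d) → Set ℓ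
    Image f A x = ∃[ y ] (A y × map (coords f) y ≡ x)

    Σ-image : ∀ {n d A} (f : Vec (Fin n) d) → Σset (pow n) A → Σset (pow d) (Image f A)
    Σ-image {n} f S = Σ-∃ (pow n) (Σ-app S #0 ∧Σ Σ-closed (coords f ∘T #0 ≡c ↓1))

    -- dim A < d, where repeated coordinates are harmless since the corresponding images have no interior.
    DimBelow : ℕ → ∀ {n} → (El (pow n) → Set ℓ) → Set ℓ
    DimBelow d {n} A = ∀ (f : Vec (Fin n) d) → ¬ HasInt (pow d) (Image f A)

    Separated : ∀ {a} → (El (sc ⊗ a) → Set ℓ) → R → R → El a → Set ℓ
    Separated P r w x = ∀ u v → P (u , x) → P (v , x) → Bdd sc r u → Near sc w u v → u ≡ v

    -- Each sparse fibre has its own separation radius on a bounded range. The points violating a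
    -- given radius form a Σ-set, so `eventually-avoids` makes the radius uniform.
    separated-fibres : ∀ {a} → Baire a → NowhereDense a → ∀ {P} → Σset (sc ⊗ a) P → ¬ HasInt (sc ⊗ a) P →
      ∀ r c t → 𝟎 < t → ∃[ w ] (𝟎 < w × Within a c t (Separated P r w))
    separated-fibres {a} baire nd {P} S ¬int r c t 0<t = conclude (sparse-fibres baire nd S ¬int c t 0<t)
      where
      Close : El (sc ⊗ a) → Set ℓ
      Close (w , x) = ∃[ u ] ∃[ v ] (P (u , x) × P (v , x) × Bdd sc r u × ¬ (u ≡ v) × Near sc w u v)
      Goal = ∃[ w ] (𝟎 < w × Within a c t (Separated P r w))
      Close-d : Def (sc ⊗ a) Close
      Close-d = ∃d sc (∃d sc (app-d (Σ-def S) (#1 ,T ↓3) ∧d app-d (Σ-def S) (#0 ,T ↓3) ∧d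
        Cl.def (Bdd-c sc (constant r) #1) ∧d ¬d (Cl.def (#1 ≡c #0)) ∧d Def-near sc #2 #1 #0))
      Close-Σ : ∀ w → 𝟎 < w → Σset a (λ x → Close (w , x))
      Close-Σ w _ = Σ-∃ sc (Σ-∃ sc (Σ-app S (#1 ,T ↓2) ∧Σ Σ-app S (#0 ,T ↓2) ∧Σ
        Σ-closed (Bdd-c sc (constant r) #1) ∧Σ Σ-open (¬o (#1 ≡c #0)) ∧Σ Σ-open (near-o sc (constant w) #1 #0)))
      conclude : Within a c t (λ x → Sparse (λ y → P (y , x))) → Goal
      conclude (c′ , t′ , 0<t′ , sparse) = refine
        (eventually-avoids baire nd {Close} Close-d Close-Σ 0<t′ λ x near →
          let w , 0<w , sep = sparse-separation (app-d (Σ-def S) (idT ,T constant x)) (proj₂ (sparse x near)) (⊖ r) r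
          in w , 0<w , λ w′ _ w′≤w (u , v , Pu , Pv , (l , h) , u≢v , near) →
               u≢v (sep u Pu l h v Pv (near-mono sc w′≤w near)))
        where
        refine : ∃[ w ] (𝟎 < w × Within a c′ t′ (λ x → ¬ Close (w , x))) → Goal
        refine (w , 0<w , c″ , t″ , 0<t″ , f) = w , 0<w , c″ , t″ , 0<t″ , λ x near →
          let near′ , ¬close = f x near in
          proj₁ (sparse x near′) , λ u v Pu Pv b near″ → by-contradiction λ u≢v →
            ¬close (u , v , Pu , Pv , b , u≢v , near″)

    -- The cube is shrunk once for each condition, and by `anti` the smallest radius serves them
    -- all.
    within-all : ∀ {a n} (Φ : Fin n → R → El a → Set ℓ) → (∀ {j w w′ x} → w′ ≤ w → Φ j w x → Φ j w′ x) →
      (∀ j c t → 𝟎 < t → ∃[ w ] (𝟎 < w × Within a c t (Φ j w))) →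
      ∀ c t → 𝟎 < t → ∃[ w ] (𝟎 < w × Within a c t (λ x → ∀ j → Φ j w x))
    within-all {n = zero} Φ anti each c t 0<t = let e , 0<e = positive in e , 0<e , everywhere 0<t λ _ _ ()
    within-all {a} {suc n} Φ anti each c t 0<t = rest (each zero c t 0<t)
      where
      Goal = ∃[ w ] (𝟎 < w × Within a c t (λ x → ∀ j → Φ j w x))
      rest : ∃[ w ] (𝟎 < w × Within a c t (Φ zero w)) → Goal
      rest (w , 0<w , c′ , t′ , 0<t′ , f) = combine (within-all (λ j → Φ (suc j)) anti (λ j → each (suc j)) c′ t′ 0<t′)
        where
        combine : ∃[ w ] (𝟎 < w × Within a c′ t′ (λ x → ∀ j → Φ (suc j) w x)) → Goal
        combine (w′ , 0<w′ , c″ , t″ , 0<t″ , g) =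
          let v , 0<v , v≤w , v≤w′ = min₊ 0<w 0<w′ in
          v , 0<v , c″ , t″ , 0<t″ , λ x near →
            let near′ , tail = g x near
                near″ , head = f x near′
            in near″ , λ { zero → anti v≤w head ; (suc j) → anti v≤w′ (tail j) }

    record Localization {n d k} (f : Vec (Fin n) d) (K : El (pow n) → Set ℓ) (ε : R) (g : Fin k → Fin n)
                        (c : El (pow d)) (t : R) : Set (s ⊔ lsuc ℓ) where
      field
        K′       : El (pow n) → Set ℓ
        K′-c     : Cl (pow n) K′
        K′⊆K     : ∀ y → K′ y → K y
        diameter : ∀ i y y′ → K′ y → K′ y′ → map (coord (g i)) y ≤ map (coord (g i)) y′ ⊕ ε
        onto     : Within (pow d) c t (Image f K′)

    -- One coordinate at a time: `bounded-section`, applied to the values of that coordinate on the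
    -- fibres over `x`, finds a slab of width `ε` that still maps onto a smaller cube. The bound `r`
    -- keeps the set of these values closed.
    localize : ∀ {n d} (f : Vec (Fin n) d) {K} → Cl (pow n) K → ∀ {r} → (∀ y → K y → Bdd (pow n) r y) →
      ∀ {ε} → 𝟎 < ε → ∀ k (g : Fin k → Fin n) {c t} → 𝟎 < t →
      (∀ x → Near (pow d) t c x → Image f K x) → Localization f K ε g c t
    localize f {K} C bdd 0<ε zero g 0<t onto =
      record { K′ = K ; K′-c = C ; K′⊆K = λ _ p → p ; diameter = λ () ; onto = everywhere 0<t onto }
    localize {n} {d} f {K} C {r} bdd {ε} 0<ε (suc k) g {c} {t} 0<t onto =
      extend (localize f C bdd 0<ε k (λ i → g (suc i)) 0<t onto)
      where
      j = coord (g zero)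
      extend : Localization f K ε (λ i → g (suc i)) c t → Localization f K ε g c t
      extend record { K′ = K₁ ; K′-c = C₁ ; K′⊆K = K₁⊆K ; diameter = diam ; onto = c′ , t′ , 0<t′ , onto₁ } =
        slice (bounded-section {K = λ (u , x) → ∃[ y ] (Bdd (pow n) r y × K₁ y × map j y ≡ u × map (coords f) y ≡ x)}
          (∃Bddc (pow n) (app-c C₁ #0 ∧c j ∘T #0 ≡c #1 ∧c coords f ∘T #0 ≡c ↓2) (constant r))
          (⊖ r) r 0<ε 0<t′ λ x near →
            let y , K₁y , eq = proj₂ (onto₁ x near)
                b = bdd y (K₁⊆K y K₁y)
            in map j y , Bdd-coord (g zero) b , y , b , K₁y , refl , eq)
        where
        slice : ∃[ u₀ ] Within (pow d) c′ t′ (λ x → ∃[ u ] ((u₀ ≤ u × u ≤ u₀ ⊕ ε) ×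
                  ∃[ y ] (Bdd (pow n) r y × K₁ y × map j y ≡ u × map (coords f) y ≡ x))) →
                Localization f K ε g c t
        slice (u₀ , c″ , t″ , 0<t″ , h) = record
          { K′ = λ y → K₁ y × u₀ ≤ map j y × map j y ≤ u₀ ⊕ ε
          ; K′-c = C₁ ∧c constant u₀ ≤c j ∧c j ≤c constant (u₀ ⊕ ε)
          ; K′⊆K = λ y (p , _) → K₁⊆K y p
          ; diameter = λ where
              zero    y y′ (_ , _ , h) (_ , l , _) → ≤-trans h (⊕-monoˡ-≤ ε l)
              (suc i) y y′ (p , _)     (p′ , _)     → diam i y y′ p p′
          ; onto = c″ , t″ , 0<t″ , λ x near → section (h x near)
          }
          where
          section : ∀ {x} → Near (pow d) t′ c′ x × ∃[ u ] ((u₀ ≤ u × u ≤ u₀ ⊕ ε) ×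
                      ∃[ y ] (Bdd (pow n) r y × K₁ y × map j y ≡ u × map (coords f) y ≡ x)) →
                    Near (pow d) t c x × Image f (λ y → K₁ y × u₀ ≤ map j y × map j y ≤ u₀ ⊕ ε) x
          section (near , _ , (l , h) , y , _ , K₁y , refl , eq) =
            proj₁ (onto₁ _ near) , y , (K₁y , l , h) , eq

    -- Local closedness and the drop in dimension.

    -- Near the point, `A` is relatively closed. Points exterior to `A` qualify as well, hence the
    -- first conjunct of `Bad`.
    LocallyClosed : ∀ {a} → (El a → Set ℓ) → El a → Set ℓ
    LocallyClosed A = Int (λ z → A z ⊎ Int (λ w → ¬ A w) z)

    LocallyClosed-o : ∀ {a A} → Def a A → Op a (LocallyClosed A)
    LocallyClosed-o D = Int-o (D ∨d Op.def (Int-o (¬d D)))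

    Bad : ∀ {a} → (El a → Set ℓ) → El a → Set ℓ
    Bad A y = A y × ¬ LocallyClosed A y

    Bad-Σ : ∀ {a A} → Σset a A → Σset a (Bad A)
    Bad-Σ S = S ∧Σ Σ-closed (¬c (LocallyClosed-o (Σ-def S)))

    -- If the bad part has an image with interior then so has a compact subset K. Over a small cube the
    -- fibres of A are uniformly discrete on K, so cutting K down to a small box turns it into
    -- the graph of a map; but then A coincides with K, which is closed, near the points of K.
    bad-dim : ∀ {n d A} → Σset (pow n) A → DimBelow (suc d) A → DimBelow d (Bad A)
    bad-dim {n} {d} {A} S dim f (c , t , 0<t , ⊆image) =
      compact (baire d I.closed I.mono (c , t , 0<t , λ x near → I.cover x (⊆image x near)))
      where
      module B = Σset (Bad-Σ S)
      module I = Σset (Σ-image f (Bad-Σ S))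
      compact : ¬ (∃[ r ] ∃[ s ] (𝟎 < s × HasInt (pow d) (λ x → I.F (r , s , x))))
      compact (r , s , 0<s , c , t , 0<t , ⊆I) = separate
        (within-all (λ j → Separated (Image (j ∷ f) A) r)
          (λ w′≤w sep u v Pu Pv b near → sep u v Pu Pv b (near-mono sc w′≤w near))
          (λ j → separated-fibres (baire d) (nowhereDense d) (Σ-image (j ∷ f) S) (dim (j ∷ f)) r) c t 0<t)
        where
        K : El (pow n) → Set ℓ
        K y = Bdd (pow n) r y × B.F (r , s , y)
        K-c : Cl (pow n) K
        K-c = Bdd-c (pow n) (constant r) idT ∧c app-c B.closed (constant r ,T constant s ,T idT)
        AllSeparated : R → El (pow d) → Set ℓ
        AllSeparated w x = ∀ j → Separated (Image (j ∷ f) A) r w x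
        separate : ¬ (∃[ w ] (𝟎 < w × Within (pow d) c t (AllSeparated w)))
        -- A point of the small box and a point near `y₀` differ by less than `ε ⊕ ε` in each
        -- coordinate, which has to stay within the separation `w`.
        separate (w , 0<w , c₁ , t₁ , 0<t₁ , sep) = cut (halve 0<w)
          where
          cut : ¬ (∃[ ε ] (𝟎 < ε × ε ⊕ ε ≤ w))
          cut (ε , 0<ε , ε+ε≤w) = graph-like (localize f K-c (λ _ → proj₁) 0<ε n (λ i → i) 0<t₁
            λ x near → let y , b , Fy , eq = ⊆I x (proj₁ (sep x near)) in y , (b , Fy) , eq)
            where
            graph-like : ¬ Localization f K ε (λ i → i) c₁ t₁
            graph-like record { K′ = K′ ; K′-c = K′-c ; K′⊆K = K′⊆K ; diameter = diam ; onto = c₂ , t₂ , 0<t₂ , onto } =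
              centre (onto c₂ (near-refl (pow d) 0<t₂))
              where
              inA : ∀ y → K′ y → A y
              inA y p = proj₁ (B.sound 0<s (proj₂ (K′⊆K y p)))
              centre : ¬ (Near (pow d) t₁ c₁ c₂ × Image f K′ c₂)
              centre (_ , y₀ , K′y₀ , refl) = radius (cont (coords f) y₀ 0<t₂)
                where
                -- Over the image of `z` there is also some `y` in `K′`. For each `j` the
                -- coordinates of `y` and `z` lie in one fibre of `Image (j ∷ f) A` and are closer
                -- than `w`, so separation forces `y ≡ z`.
                coincide : ∀ z → A z → Near (pow n) ε y₀ z → Near (pow d) t₂ c₂ (map (coords f) z) → K′ z
                coincide z Az near-z near-x = same (onto _ near-x)
                  where
                  same : Near (pow d) t₁ c₁ (map (coords f) z) × Image f K′ (map (coords f) z) → K′ z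
                  same (near-c₁ , y , K′y , eq) = subst K′ (coord-ext n coords-agree) K′y
                    where
                    close : ∀ {p q z} → p ≤ q ⊕ ε → q < z ⊕ ε → p < z ⊕ w
                    close {z = z} p≤q+ε q<z+ε = ≤-<-trans p≤q+ε (<-≤-trans (⊕-monoˡ-< ε q<z+ε)
                      (≤-trans (≤-reflexive (assoc z ε ε)) (⊕-monoʳ-≤ z ε+ε≤w)))
                    close′ : ∀ {p q z} → q ≤ p ⊕ ε → z < q ⊕ ε → z < p ⊕ w
                    close′ {p} q≤p+ε z<q+ε = <-≤-trans z<q+ε (≤-trans (⊕-monoˡ-≤ ε q≤p+ε)
                      (≤-trans (≤-reflexive (assoc p ε ε)) (⊕-monoʳ-≤ p ε+ε≤w)))
                    coords-agree : ∀ j → map (coord j) y ≡ map (coord j) z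
                    coords-agree j = proj₂ (sep _ near-c₁) j _ _
                      (y , inA y K′y , cong₂ _,_ refl eq) (z , Az , refl)
                      (Bdd-coord j (proj₁ (K′⊆K y K′y)))
                      ( close (diam j y y₀ K′y K′y₀) (proj₁ (near-coord j near-z))
                      , close′ (diam j y₀ y K′y₀ K′y) (proj₂ (near-coord j near-z)))
                radius : ¬ (∃[ u ] (𝟎 < u × (∀ z → Near (pow n) u y₀ z → Near (pow d) t₂ c₂ (map (coords f) z))))
                radius (u , 0<u , near-image) = shrink (min₊ 0<u 0<ε)
                  where
                  shrink : ¬ (∃[ v ] (𝟎 < v × v ≤ u × v ≤ ε))
                  -- As a point of `K`, `y₀` is bad; but `A` agrees near it with the closed set
                  -- `K′`, so it is locally closed there.
                  shrink (v , 0<v , v≤u , v≤ε) = proj₂ (B.sound 0<s (proj₂ (K′⊆K y₀ K′y₀))) (v , 0<v , good)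
                    where
                    good : ∀ z → Near (pow n) v y₀ z → A z ⊎ Int (λ w → ¬ A w) z
                    good z near with em {A z}
                    ... | yes Az = inj₁ Az
                    ... | no ¬Az =
                      let p , 0<p , avoids = Cl.nbhd K′-c z (λ K′z → ¬Az (inA z K′z))
                          q , 0<q , inside = near-c (pow n) y₀ v z near
                          m , 0<m , m≤p , m≤q = min₊ 0<p 0<q
                      in inj₂ (m , 0<m , λ z′ near′ Az′ →
                           let near-z′ = inside z′ (near-mono (pow n) m≤q near′) in
                           avoids z′ (near-mono (pow n) m≤p near′) (coincide z′ Az′
                             (near-mono (pow n) v≤ε near-z′) (near-image z′ (near-mono (pow n) v≤u near-z′))))

    separates : ∀ {m} (i j : Fin m) → i Fin.< j → ∀ c {t} → 𝟎 < t →
      ∃[ x ] (Near (pow m) t c x × ¬ (map (coord i) x ≡ map (coord j) x))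
    separates {suc m} zero (suc j) _ (c , cs) {t} 0<t with em {c ≡ map (coord j) cs}
    ... | no c≢ = (c , cs) , near-refl (sc ⊗ pow m) 0<t , c≢
    ... | yes refl = let u , 0<u , u<t = dense 0<t in
      (c ⊕ u , cs) , ((<-trans (x<x⊕t 0<u) (x<x⊕t 0<t) , ⊕-monoʳ-< c u<t) , near-refl (pow m) 0<t)
      , λ eq → <-irrefl (subst (c <_) eq (x<x⊕t 0<u))
    separates (suc i) (suc j) (s<s i<j) (c , cs) 0<t =
      let x , near , ≢ = separates i j i<j cs 0<t in (c , x) , (near-refl sc 0<t , near) , ≢

    -- By the pigeonhole principle a list of `suc n` coordinates out of `n` repeats one, so the
    -- image lies in a diagonal, which contains no cube.
    dim<1+n : ∀ {n} (A : El (pow n) → Set ℓ) → DimBelow (suc n) A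
    dim<1+n {n} A f (c , t , 0<t , ⊆image) =
      let i , j , i<j , fi≡fj = pigeonhole (n<1+n n) (lookup f)
          x , near , xi≢xj = separates i j i<j c 0<t
          y , _ , eq = ⊆image x near
      in xi≢xj (subst (λ x → map (coord i) x ≡ map (coord j) x) eq
           (trans (coord-coords f i y) (trans (cong (λ k → map (coord k) y) fi≡fj) (sym (coord-coords f j y)))))

    -- Boolean combinations of definable open sets.

    -- A normal form for these combinations: an existential quantifier distributes over the unions
    -- and then meets only differences of open sets.
    data DC (a : Ty) : (El a → Set ℓ) → Set (s ⊔ lsuc ℓ) where
      piece : ∀ {U V} → Op a U → Op a V → DC a (λ x → U x × ¬ V x)
      _∪′_  : ∀ {P Q} → DC a P → DC a Q → DC a (λ x → P x ⊎ Q x)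
      resp  : ∀ {P Q} → DC a P → (∀ x → P x ⇔ Q x) → DC a Q

    full-o : ∀ {a} → Op a (λ _ → ⊤)
    full-o = mkOp true-d λ _ _ → let e , 0<e = positive in e , 0<e , λ _ _ → tt

    empty-o : ∀ {a} → Op a (λ _ → ¬ ⊤)
    empty-o = mkOp (¬d true-d) λ _ ¬⊤ → ⊥-elim (¬⊤ tt)

    DC-open : ∀ {a U} → Op a U → DC a U
    DC-open o = resp (piece o empty-o) λ x → mk⇔ proj₁ (λ u → u , λ ¬⊤ → ¬⊤ tt)

    DC-closed : ∀ {a V} → Op a V → DC a (λ x → ¬ V x)
    DC-closed o = resp (piece full-o o) λ x → mk⇔ proj₂ (λ ¬v → tt , ¬v)

    DC-∩ : ∀ {a P Q} → DC a P → DC a Q → DC a (λ x → P x × Q x)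
    DC-∩ (resp p f) q = resp (DC-∩ p q) λ x → mk⇔ (λ (p , q) → to (f x) p , q) (λ (p , q) → from (f x) p , q)
    DC-∩ (p ∪′ p′) q = resp (DC-∩ p q ∪′ DC-∩ p′ q) λ x → mk⇔
      [ (λ (p , q) → inj₁ p , q) , (λ (p , q) → inj₂ p , q) ]′
      λ { (inj₁ p , q) → inj₁ (p , q) ; (inj₂ p , q) → inj₂ (p , q) }
    DC-∩ p@(piece _ _) (resp q f) = resp (DC-∩ p q) λ x →
      mk⇔ (λ (p , q) → p , to (f x) q) (λ (p , q) → p , from (f x) q)
    DC-∩ p@(piece _ _) (q ∪′ q′) = resp (DC-∩ p q ∪′ DC-∩ p q′) λ x → mk⇔
      [ (λ (p , q) → p , inj₁ q) , (λ (p , q) → p , inj₂ q) ]′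
      λ { (p , inj₁ q) → inj₁ (p , q) ; (p , inj₂ q) → inj₂ (p , q) }
    DC-∩ (piece u v) (piece u′ v′) = resp (piece (u ∧o u′) (v ∨o v′)) λ x → mk⇔
      (λ ((u , u′) , ¬v) → (u , λ v → ¬v (inj₁ v)) , (u′ , λ v′ → ¬v (inj₂ v′)))
      λ ((u , ¬v) , (u′ , ¬v′)) → (u , u′) , [ ¬v , ¬v′ ]′

    DC-¬ : ∀ {a P} → DC a P → DC a (λ x → ¬ P x)
    DC-¬ (resp p f) = resp (DC-¬ p) λ x → mk⇔ (λ ¬p q → ¬p (from (f x) q)) (λ ¬q p → ¬q (to (f x) p))
    DC-¬ (p ∪′ q) = resp (DC-∩ (DC-¬ p) (DC-¬ q)) λ x → mk⇔ (λ (¬p , ¬q) → [ ¬p , ¬q ]′)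
      (λ ¬pq → (λ p → ¬pq (inj₁ p)) , λ q → ¬pq (inj₂ q))
    DC-¬ (piece {U} {V} u v) = resp (DC-closed u ∪′ DC-open v) λ x → mk⇔
      (λ { (inj₁ ¬u) (u , _) → ¬u u ; (inj₂ v) (_ , ¬v) → ¬v v }) (split x)
      where
      split : ∀ x → ¬ (U x × ¬ V x) → ¬ U x ⊎ V x
      split x n with em {V x}
      ... | yes v = inj₂ v
      ... | no ¬v = inj₁ λ u → n (u , ¬v)

    DC-app : ∀ {a b P} → DC b P → (f : Tm a b) → DC a (λ x → P (map f x))
    DC-app (piece u v) f = piece (app-o u f) (app-o v f)
    DC-app (p ∪′ q) f = DC-app p f ∪′ DC-app q f
    DC-app (resp p e) f = resp (DC-app p f) λ x → e (map f x)

    -- Off its bad part, `A` is the difference of two open sets, its locally closed locus and its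
    -- exterior; the bad part has a smaller dimension bound. At bound zero the only projection is
    -- onto a point, so `A` is empty.
    Σ-DC : ∀ {n} d {A} → Σset (pow n) A → DimBelow d A → DC (pow n) A
    Σ-DC zero {A} S dim = resp (DC-open empty-o) λ x → mk⇔ (λ ¬⊤ → ⊥-elim (¬⊤ tt))
      λ Ax → ⊥-elim (let e , 0<e = positive in dim [] (tt , e , 0<e , λ _ _ → x , Ax , refl))
    Σ-DC (suc d) {A} S dim =
      resp (piece (LocallyClosed-o (Σ-def S)) (Int-o (¬d (Σ-def S))) ∪′ Σ-DC d (Bad-Σ S) (bad-dim S dim))
      λ x → mk⇔ (join x) (split x)
      where
      join : ∀ x → (LocallyClosed A x × ¬ Int (λ z → ¬ A z) x) ⊎ Bad A x → A x
      join x (inj₂ (Ax , _)) = Ax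
      join x (inj₁ ((t , 0<t , f) , ¬out)) = [ (λ Ax → Ax) , (λ out → ⊥-elim (¬out out)) ]′ (f x (near-refl _ 0<t))
      split : ∀ x → A x → (LocallyClosed A x × ¬ Int (λ z → ¬ A z) x) ⊎ Bad A x
      split x Ax with em {LocallyClosed A x}
      ... | yes lc = inj₁ (lc , λ (t , 0<t , f) → f x (near-refl _ 0<t) Ax)
      ... | no ¬lc = inj₂ (Ax , ¬lc)

    -- The quantifier elimination step: a difference of open sets is a Σ-set, so is its projection,
    -- and the trivial bound `suc n` starts the induction of `Σ-DC`.
    DC-∃ : ∀ {n P} → DC (pow (suc n)) P → DC (pow n) (λ x → ∃[ y ] P (y , x))
    DC-∃ {n} (piece u v) = Σ-DC (suc n) (Σ-∃ sc (Σ-open u ∧Σ Σ-closed (¬c v))) (dim<1+n _)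
    DC-∃ (p ∪′ q) = resp (DC-∃ p ∪′ DC-∃ q) λ x → mk⇔
      [ (λ (y , p) → y , inj₁ p) , (λ (y , q) → y , inj₂ q) ]′
      λ { (y , inj₁ p) → inj₁ (y , p) ; (y , inj₂ q) → inj₂ (y , q) }
    DC-∃ (resp p f) = resp (DC-∃ p) λ x →
      mk⇔ (λ (y , p) → y , to (f (y , x)) p) (λ (y , q) → y , from (f (y , x)) q)

    -- Sets definable in the open core.

    lookup-toVec : ∀ {n} (i : Fin n) x → lookup (toVec n x) i ≡ map (coord i) x
    lookup-toVec zero    x = refl
    lookup-toVec (suc i) x = lookup-toVec i (proj₂ x)

    private
      𝓛 = openCoreLanguage order M
      𝓞 = openCore order M

    variable-of : ∀ {n} → Term 𝓛 n → Fin n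
    variable-of (var i)               = i
    variable-of (app (Level.lift ()) _)

    eval-core : ∀ {n} (t : Term 𝓛 n) x → eval 𝓞 (toVec n x) t ≡ map (coord (variable-of t)) x
    eval-core (var i)                x = lookup-toVec i x
    eval-core (app (Level.lift ()) _)

    evals-core : ∀ {n k} (ts : Vec (Term 𝓛 n) k) x →
      evals 𝓞 (toVec n x) ts ≡ toVec k (map (coords (Vec.map variable-of ts)) x)
    evals-core []       x = refl
    evals-core (t ∷ ts) x = cong₂ _∷_ (eval-core t x) (evals-core ts x)

    subst-⇔ : ∀ {A : Set ℓ} (P : A → Set ℓ) {x y} → x ≡ y → P x ⇔ P y
    subst-⇔ P refl = mk⇔ (λ p → p) (λ p → p)

    DC-core : ∀ {n} (φ : Formula 𝓛 n) → DC (pow n) (λ x → Sat 𝓞 φ (toVec n x))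
    DC-core (t ≈′ u) = resp (DC-closed (¬o (coord (variable-of t) ≡c coord (variable-of u)))) λ x → mk⇔
      (λ ¬¬p → trans (eval-core t x) (trans (by-contradiction ¬¬p) (sym (eval-core u x))))
      (λ p ¬p → ¬p (trans (sym (eval-core t x)) (trans p (eval-core u x))))
    DC-core (atom (U , _ , D , open-U) ts) = resp
      (DC-app (DC-open (mkOp (Definable⇒Def D) (IsOpen⇒IsOp open-U))) (coords (Vec.map variable-of ts)))
      λ x → subst-⇔ U (sym (evals-core ts x))
    DC-core (¬′ φ)   = DC-¬ (DC-core φ)
    DC-core (φ ∧′ ψ) = DC-∩ (DC-core φ) (DC-core ψ)
    DC-core (φ ∨′ ψ) = DC-core φ ∪′ DC-core ψ
    DC-core (∃′ φ)   = DC-∃ (DC-core φ)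
    DC-core (∀′ φ)   = resp (DC-¬ (DC-∃ (DC-¬ (DC-core φ)))) λ x →
      mk⇔ (λ ¬∃ y → by-contradiction λ ¬p → ¬∃ (y , ¬p)) (λ p (y , ¬p) → ¬p (p y))

    -- `DC-core` treats formulas without parameters; parameters enter by substitution along this
    -- map.
    prepend : ∀ {m n} → Vec R m → Tm (pow n) (pow (m + n))
    prepend []      = idT
    prepend (k ∷ c) = constant k ,T prepend c

    toVec-prepend : ∀ {m} n (c : Vec R m) x → toVec (m + n) (map (prepend c) x) ≡ c ++ toVec n x
    toVec-prepend n []      x = refl
    toVec-prepend n (k ∷ c) x = cong (k ∷_) (toVec-prepend n c x)

    definable⇒DC : ∀ {n} {X : Vec R n → Set ℓ} → Definable 𝓞 X → DC (pow n) (λ x → X (toVec n x))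
    definable⇒DC {n} (m , φ , c , d) = resp (DC-app (DC-core φ) (prepend c)) λ x →
      mk⇔ (λ p → from (d _) (subst (Sat 𝓞 φ) (toVec-prepend n c x) p))
          (λ q → subst (Sat 𝓞 φ) (sym (toVec-prepend n c x)) (to (d _) q))

    fromVec-toVec : ∀ n x → fromVec (toVec n x) ≡ x
    fromVec-toVec zero    x       = refl
    fromVec-toVec (suc n) (x , y) = cong (x ,_) (fromVec-toVec n y)

    DC⇒constructible : ∀ {n P} → DC (pow n) P → Constructible order (λ v → P (fromVec v))
    DC⇒constructible {n} (piece u v) = intersection (isOpen u) (complement (isOpen v))
      where
      isOpen : ∀ {U} → Op (pow n) U → Constructible order (λ v → U (fromVec v))
      isOpen {U} o = open-set (IsOp⇒IsOpen (Op.nbhd (resp-o o λ x → subst-⇔ U (sym (fromVec-toVec n x)))))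
    DC⇒constructible (p ∪′ q) = union (DC⇒constructible p) (DC⇒constructible q)
    DC⇒constructible (resp p f) = respects ((λ {v} → to (f (fromVec v))) , λ {v} → from (f (fromVec v)))
      (DC⇒constructible p)

    definable⇒constructible : ∀ {n} (X : Vec R n → Set ℓ) → Definable 𝓞 X → Constructible order X
    definable⇒constructible X D = respects
      ((λ {v} → subst X (toVec-fromVec v)) , λ {v} → subst X (sym (toVec-fromVec v)))
      (DC⇒constructible (definable⇒DC D))

    -- Germs on the line and local o-minimality.

    ConstantOn : (S X : R → Set ℓ) → Set ℓ
    ConstantOn S X = (∀ x → S x → X x) ⊎ (∀ x → S x → ¬ X x)

    constant-⊆ : ∀ {S T X} → (∀ x → S x → T x) → ConstantOn T X → ConstantOn S X
    constant-⊆ S⊆T (inj₁ f) = inj₁ λ x Sx → f x (S⊆T x Sx)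
    constant-⊆ S⊆T (inj₂ f) = inj₂ λ x Sx → f x (S⊆T x Sx)

    constant-¬ : ∀ {S X} → ConstantOn S X → ConstantOn S (λ x → ¬ X x)
    constant-¬ (inj₁ f) = inj₂ λ x Sx ¬Xx → ¬Xx (f x Sx)
    constant-¬ (inj₂ f) = inj₁ f

    constant-∩ : ∀ {S X Y} → ConstantOn S X → ConstantOn S Y → ConstantOn S (λ x → X x × Y x)
    constant-∩ (inj₁ f) (inj₁ g) = inj₁ λ x Sx → f x Sx , g x Sx
    constant-∩ (inj₂ f) _        = inj₂ λ x Sx (p , _) → f x Sx p
    constant-∩ (inj₁ _) (inj₂ g) = inj₂ λ x Sx (_ , q) → g x Sx q

    constant-∪ : ∀ {S X Y} → ConstantOn S X → ConstantOn S Y → ConstantOn S (λ x → X x ⊎ Y x)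
    constant-∪ (inj₁ f) _        = inj₁ λ x Sx → inj₁ (f x Sx)
    constant-∪ (inj₂ _) (inj₁ g) = inj₁ λ x Sx → inj₂ (g x Sx)
    constant-∪ (inj₂ f) (inj₂ g) = inj₂ λ x Sx → [ f x Sx , g x Sx ]′

    constant-resp : ∀ {S X Y} → (∀ x → X x ⇔ Y x) → ConstantOn S X → ConstantOn S Y
    constant-resp X⇔Y (inj₁ f) = inj₁ λ x Sx → to (X⇔Y x) (f x Sx)
    constant-resp X⇔Y (inj₂ f) = inj₂ λ x Sx Yx → f x Sx (from (X⇔Y x) Yx)

    Segment : R → R → R → Set ℓ
    Segment u v x = u ≤ x × x ≤ v

    -- Definable connectedness: `U` is locally constant on the interval, so by interval induction it
    -- is constant on the closed segment spanned by any two of its points.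
    interval-connected : ∀ {U} → Op sc U → ∀ p q →
      (∀ x → Interval order p q x → U x ⊎ Int (λ y → ¬ U y) x) → ConstantOn (Interval order p q) U
    interval-connected {U} o p q clopen with em {∃[ x ] (Interval order p q x × U x)}
    ... | no ¬∃ = inj₂ λ x x∈I Ux → ¬∃ (x , x∈I , Ux)
    ... | yes (x , x∈I@(p<x , x<q) , Ux) = inj₁ λ y y∈I@(p<y , y<q) →
      [ (λ x≤y → [ (λ f → f y (x≤y , ≤-refl)) , (λ f → ⊥-elim (f x (≤-refl , x≤y) Ux)) ]′ (segment p<x x≤y y<q))
      , (λ y<x → let y≤x = <-asym y<x in
                 [ (λ f → f y (≤-refl , y≤x)) , (λ f → ⊥-elim (f x (y≤x , ≤-refl) Ux)) ]′ (segment p<y y≤x x<q))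
      ]′ (≤-or-> x y)
      where
      segment-d : Def (sc ⊗ sc) (λ (u , v) → ConstantOn (Segment u v) U)
      segment-d = ∀d sc ((#1 ≤d #0 ∧d #0 ≤d ↓2) ⇒d app-d (Op.def o) #0)
                  ∨d ∀d sc ((#1 ≤d #0 ∧d #0 ≤d ↓2) ⇒d ¬d (app-d (Op.def o) #0))
      glue : ∀ {u v w} → u ≤ v → v ≤ w → ConstantOn (Segment u v) U → ConstantOn (Segment v w) U →
        ConstantOn (Segment u w) U
      glue {v = v} _ _ (inj₁ f) (inj₁ g) = inj₁ λ x (l , h) →
        [ (λ x≤v → f x (l , x≤v)) , (λ v<x → g x (<-asym v<x , h)) ]′ (≤-or-> x v)
      glue {v = v} _ _ (inj₂ f) (inj₂ g) = inj₂ λ x (l , h) →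
        [ (λ x≤v → f x (l , x≤v)) , (λ v<x → g x (<-asym v<x , h)) ]′ (≤-or-> x v)
      glue {v = v} u≤v v≤w (inj₁ f) (inj₂ g) = ⊥-elim (g v (≤-refl , v≤w) (f v (u≤v , ≤-refl)))
      glue {v = v} u≤v v≤w (inj₂ f) (inj₁ g) = ⊥-elim (f v (u≤v , ≤-refl) (g v (≤-refl , v≤w)))
      segment : ∀ {u v} → p < u → u ≤ v → v < q → ConstantOn (Segment u v) U
      segment p<u u≤v v<q = interval-induction (λ u v → ConstantOn (Segment u v) U) segment-d
        (λ u≤ ≤v → constant-⊆ λ x (l , h) → ≤-trans u≤ l , ≤-trans h ≤v) glue u≤v
        λ c u≤c c≤v → local c (clopen c (<-≤-trans p<u u≤c , ≤-<-trans c≤v v<q))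
        where
        Local = λ c → ∃[ a ] ∃[ b ] (a < c × c < b × ConstantOn (Segment a b) U)
        local : ∀ c → U c ⊎ Int (λ y → ¬ U y) c → Local c
        local c (inj₁ Uc) =
          let t , 0<t , f = Op.nbhd o c Uc
              a , b , a<c , c<b , near = around c 0<t
          in a , b , a<c , c<b , inj₁ λ x (l , h) → f x (near x l h)
        local c (inj₂ (t , 0<t , f)) =
          let a , b , a<c , c<b , near = around c 0<t
          in a , b , a<c , c<b , inj₂ λ x (l , h) → f x (near x l h)

    -- Nothing is demanded at `a` itself, which later becomes a point piece of its own.
    Germ : (R → Set ℓ) → R → Set ℓ
    Germ X a = ∃[ p ] ∃[ q ] (p < a × a < q ×
      ConstantOn (Interval order p a) X × ConstantOn (Interval order a q) X)

    larger : ∀ {p p′ a} → p < a → p′ < a → ∃[ m ] (m < a × p ≤ m × p′ ≤ m)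
    larger {p} {p′} p<a p′<a with ≤-or-> p p′
    ... | inj₁ p≤p′ = p′ , p′<a , p≤p′ , ≤-refl
    ... | inj₂ p′<p = p , p<a , ≤-refl , <-asym p′<p

    smaller : ∀ {q q′ a} → a < q → a < q′ → ∃[ m ] (a < m × m ≤ q × m ≤ q′)
    smaller {q} {q′} a<q a<q′ with ≤-or-> q q′
    ... | inj₁ q≤q′ = q , a<q , ≤-refl , q≤q′
    ... | inj₂ q′<q = q′ , a<q′ , <-asym q′<q , ≤-refl

    germ-combine : ∀ {X Y Z a} → (∀ {S} → ConstantOn S X → ConstantOn S Y → ConstantOn S Z) →
      Germ X a → Germ Y a → Germ Z a
    germ-combine f (p , q , p<a , a<q , l , r) (p′ , q′ , p′<a , a<q′ , l′ , r′) =
      let m , m<a , p≤m , p′≤m = larger p<a p′<a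
          k , a<k , k≤q , k≤q′ = smaller a<q a<q′
      in m , k , m<a , a<k
         , f (constant-⊆ (λ x (m<x , x<a) → ≤-<-trans p≤m m<x , x<a) l)
             (constant-⊆ (λ x (m<x , x<a) → ≤-<-trans p′≤m m<x , x<a) l′)
         , f (constant-⊆ (λ x (a<x , x<k) → a<x , <-≤-trans x<k k≤q) r)
             (constant-⊆ (λ x (a<x , x<k) → a<x , <-≤-trans x<k k≤q′) r′)

    -- The boundary is closed, and a cube inside it would miss `U` and so be exterior to `U`. Hence
    -- the boundary is sparse, short intervals on either side of `a` miss it, and `U` is constant on
    -- each.
    germ-open : ∀ {U} → Op sc U → ∀ a → Germ U a
    germ-open {U} o a = near-boundary (closed⇒sparse (¬c o ∧c ¬c (Int-o (¬d (Op.def o)))) boundary-no-int a)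
      where
      Boundary : R → Set ℓ
      Boundary x = ¬ U x × ¬ Int (λ y → ¬ U y) x
      boundary-no-int : ¬ HasInt sc Boundary
      boundary-no-int (c , t , 0<t , f) =
        proj₂ (f c (near-refl sc 0<t)) (t , 0<t , λ y near → proj₁ (f y near))
      off-boundary : ∀ x → ¬ Boundary x → U x ⊎ Int (λ y → ¬ U y) x
      off-boundary x ¬b with em {U x}
      ... | yes Ux = inj₁ Ux
      ... | no ¬Ux = inj₂ (by-contradiction λ ¬int → ¬b (¬Ux , ¬int))
      near-boundary : ∃[ t ] (𝟎 < t × (∀ x → Boundary x → Near sc t a x → x ≡ a)) → Germ U a
      near-boundary (t , 0<t , isolated) = a ⊕ ⊖ t , a ⊕ t , x⊖t<x 0<t , x<x⊕t 0<t
        , interval-connected o _ _ (λ x (l , x<a) → off-boundary x λ b → <-irrefl (subst (_< a)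
            (isolated x b (subst (_< x ⊕ t) (⊖-cancelʳ a t) (⊕-monoˡ-< t l) , <-trans x<a (x<x⊕t 0<t))) x<a))
        , interval-connected o _ _ (λ x (a<x , h) → off-boundary x λ b → <-irrefl (subst (a <_)
            (isolated x b (<-trans a<x (x<x⊕t 0<t) , h)) a<x))

    germ : ∀ {X} → DC sc X → ∀ a → Germ X a
    germ (piece u v) a = germ-combine (λ p q → constant-∩ p (constant-¬ q)) (germ-open u a) (germ-open v a)
    germ (p ∪′ q) a = germ-combine constant-∪ (germ p a) (germ q a)
    germ (resp p f) a = germ-combine (λ c _ → constant-resp f c) (germ p a) (germ p a)

    locallyOMinimal : LocallyOMinimal order 𝓞
    locallyOMinimal X D a = pieces (germ (DC-app (definable⇒DC D) (idT ,T !T)) a)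
      where
      Represented : (R → Set ℓ) → Set ℓ
      Represented S = ∃[ ps ] (∀ x → S x ⇔ Union order ps x)
      constant-piece : ∀ p q → ConstantOn (Interval order p q) X →
        Represented (λ x → Interval order p q x × X x)
      constant-piece p q (inj₁ f) = interval p q List.∷ List.[] , λ x →
        mk⇔ (λ (x∈I , _) → here x∈I) λ { (here x∈I) → x∈I , f x x∈I }
      constant-piece p q (inj₂ f) = List.[] , λ x → mk⇔ (λ (x∈I , Xx) → ⊥-elim (f x x∈I Xx)) λ ()
      point-piece : Dec (X a) → Represented (λ x → x ≡ a × X x)
      point-piece (yes Xa) = point a List.∷ List.[] , λ x →
        mk⇔ (λ (x≡a , _) → here x≡a) λ { (here refl) → refl , Xa }
      point-piece (no ¬Xa) = List.[] , λ x → mk⇔ (λ { (refl , Xa) → ⊥-elim (¬Xa Xa) }) λ ()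
      represented-∪ : ∀ {S T} → Represented S → Represented T → Represented (λ x → S x ⊎ T x)
      represented-∪ (ps , f) (qs , g) = ps List.++ qs , λ x → mk⇔
        [ (λ Sx → ++⁺ˡ (to (f x) Sx)) , (λ Tx → ++⁺ʳ ps (to (g x) Tx)) ]′
        λ u → [ (λ p → inj₁ (from (f x) p)) , (λ q → inj₂ (from (g x) q)) ]′ (++⁻ ps u)
      pieces : Germ X a → ∃[ b ] ∃[ c ] (Interval order b c a ×
        (∃[ ps ] (λ x → X x × Interval order b c x) ≐ Union order ps))
      pieces (p , q , p<a , a<q , l , r) = assemble
        (represented-∪ (constant-piece p a l) (represented-∪ (point-piece em) (constant-piece a q r)))
        where
        Parts : R → Set ℓ
        Parts x = (Interval order p a x × X x) ⊎ ((x ≡ a × X x) ⊎ (Interval order a q x × X x))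
        split : ∀ x → X x → Interval order p q x → Parts x
        split x Xx (p<x , x<q) with IsDenseLinearOrder.compare isDenseLinearOrder x a
        ... | tri< x<a _ _ = inj₁ ((p<x , x<a) , Xx)
        ... | tri≈ _ x≡a _ = inj₂ (inj₁ (x≡a , Xx))
        ... | tri> _ _ a<x = inj₂ (inj₂ ((a<x , x<q) , Xx))
        join : ∀ x → Parts x → X x × Interval order p q x
        join x (inj₁ ((p<x , x<a) , Xx))        = Xx , p<x , <-trans x<a a<q
        join x (inj₂ (inj₁ (refl , Xx)))        = Xx , p<a , a<q
        join x (inj₂ (inj₂ ((a<x , x<q) , Xx))) = Xx , <-trans p<a a<x , x<q
        assemble : Represented Parts → ∃[ b ] ∃[ c ] (Interval order b c a ×
          (∃[ ps ] (λ x → X x × Interval order b c x) ≐ Union order ps))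
        assemble (ps , f) = p , q , (p<a , a<q) , ps
          , (λ {x} (Xx , x∈I) → to (f x) (split x Xx x∈I)) , λ {x} u → join x (from (f x) u)

theorem1p1 : (∀ {p : Level} → ExcludedMiddle p) →
    ∀ {s ℓ : Level} {L : Language s} {R : Set ℓ}
    (G : DenseOrderedAbelianGroup R) (M : Structure L R) →
    ExpandsGroup G M →
    let O = DenseOrderedAbelianGroup.order G in
    DefinablyComplete O M →
    (ClosedSetsDiscreteOrInterval O M ⇔ LocallyOMinimal O (openCore O M)) ×
    ((ClosedSetsDiscreteOrInterval O M ⊎ LocallyOMinimal O (openCore O M)) →
    ∀ {n : ℕ} (X : Pred (Vec R n) ℓ) →
    Definable (openCore O M) X → Constructible O X)
theorem1p1 em G M E dc =
    mk⇔ locallyOMinimal locallyOMinimal⇒closedSets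
  , λ condition X → definable⇒constructible ([ (λ h → h) , locallyOMinimal⇒closedSets ]′ condition) X
  where
  open DefinableSets em G M E dc
  open ClosedSets
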